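{- Every biconnected outerpath is $B_0$-VPG.
   Context: All graphs are finite and simple. A graph is $B_0$-VPG if it is the intersection graph of a family of axis-parallel (horizontal or vertical) line segments in the plane (degenerate point segments allowed), i.e. each vertex is assigned such a segment and two distinct vertices are adjacent if and only if their segments intersect; equivalently, a vertex intersection graph of $0$-bend paths on a grid. An outerplanar graph is a planar graph admitting a plane embedding with all vertices on the outer face. The weak dual of such an embedding is the graph whose vertices are the bounded faces, two being adjacent when the faces share an edge. An outerpath is an outerplanar graph admitting an outerplanar embedding whose weak dual is a path. A graph is biconnected if it is connected, has at least three vertices... (more precisely: it has no separator of size smaller than $2$). -}

module Defs where

open import Data.Nat using (ℕ; suc; _≤_; _<_)
open import Data.Fin using (Fin; toℕ)
open import Data.Fin.Subset using (Subset; _∈_; ∣_∣)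
open import Data.Bool using (Bool; true)
open import Data.Integer as ℤ using (ℤ)
open import Data.Product using (Σ; ∃; _×_; _,_)
open import Data.Sum using (_⊎_)
open import Relation.Nullary using (¬_)
open import Data.Empty using (⊥)
open import Relation.Binary.PropositionalEquality using (_≡_; _≢_)
open import Function.Bundles using (_⇔_)
open import Function.Definitions using (Injective)

record Graph : Set where
  field
    n      : ℕ
    adj    : Fin n → Fin n → Bool
    sym    : ∀ u v → adj u v ≡ adj v u
    irrefl : ∀ v → adj v v ≡ true → ⊥
  Adj : Fin n → Fin n → Set
  Adj u v = adj u v ≡ true

open Graph public

data Reach (G : Graph) (ok : Fin (n G) → Set) : Fin (n G) → Fin (n G) → Set where
  here : ∀ {u} → ok u → Reach G ok u u
  step : ∀ {u v w} → ok u → Adj G u v → Reach G ok v w → Reach G ok u w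

Connected : Graph → Set
Connected G = ∀ u w → Reach G (λ _ → Fin (n G)) u w

Biconnected : Graph → Set
Biconnected G =
  3 ≤ n G × Connected G ×
  (∀ x u w → u ≢ x → w ≢ x → Reach G (λ v → v ≢ x) u w)

-- Outerplanar embeddings, given combinatorially as a placement of the
-- vertices in convex position on a circle (pos v = index of v in the
-- cyclic order), edges drawn as straight chords.

module _ (G : Graph) (pos : Fin (n G) → Fin (n G)) where

  private
    _≺_ : Fin (n G) → Fin (n G) → Set
    a ≺ b = toℕ (pos a) < toℕ (pos b)

  NoCrossing : Set
  NoCrossing = ∀ a b c d → Adj G a b → Adj G c d →
               ¬ (a ≺ c × c ≺ b × b ≺ d)

  -- v immediately follows u (clockwise) among the vertices of S
  Consec : Subset (n G) → Fin (n G) → Fin (n G) → Set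
  Consec S u v =
    (u ≺ v × (∀ w → w ∈ S → ¬ (u ≺ w × w ≺ v))) ⊎
    (v ≺ u × (∀ w → w ∈ S → ¬ (u ≺ w) × ¬ (w ≺ v)))

  Side : Subset (n G) → Fin (n G) → Fin (n G) → Set
  Side S u v = Consec S u v ⊎ Consec S v u

  -- bounded faces of the drawing: polygons on ≥ 3 vertices whose sides
  -- are exactly the edges of G among them (no diagonal inside)
  Face : Subset (n G) → Set
  Face S = 3 ≤ ∣ S ∣ ×
           (∀ u v → u ∈ S → v ∈ S → u ≢ v → (Adj G u v ⇔ Side S u v))

  FaceAdj : Subset (n G) → Subset (n G) → Set
  FaceAdj S T = S ≢ T × ∃ λ u → ∃ λ v →
    u ≢ v × u ∈ S × v ∈ S × u ∈ T × v ∈ T × Adj G u v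

  WeakDualIsPath : Set
  WeakDualIsPath =
    Σ ℕ λ k → Σ (Fin k → Subset (n G)) λ F →
      1 ≤ k × Injective _≡_ _≡_ F ×
      (∀ i → Face (F i)) ×
      (∀ S → Face S → ∃ λ i → F i ≡ S) ×
      (∀ i j → (FaceAdj (F i) (F j) ⇔
                 (suc (toℕ i) ≡ toℕ j ⊎ suc (toℕ j) ≡ toℕ i)))

Outerpath : Graph → Set
Outerpath G = Σ (Fin (n G) → Fin (n G)) λ pos →
  Injective _≡_ _≡_ pos × NoCrossing G pos × WeakDualIsPath G pos

data Seg : Set where
  hor : (y x₁ x₂ : ℤ) → Seg
  ver : (x y₁ y₂ : ℤ) → Seg

_∈Seg_ : ℤ × ℤ → Seg → Set
(x , y) ∈Seg hor y' x₁ x₂ = y ≡ y' × x₁ ℤ.≤ x × x ℤ.≤ x₂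
(x , y) ∈Seg ver x' y₁ y₂ = x ≡ x' × y₁ ℤ.≤ y × y ℤ.≤ y₂

-- segments may be degenerate (single points) but not empty
NonEmpty : Seg → Set
NonEmpty s = ∃ λ p → p ∈Seg s

B₀-VPG : Graph → Set
B₀-VPG G = Σ (Fin (n G) → Seg) λ σ →
  (∀ v → NonEmpty (σ v)) ×
  (∀ u v → u ≢ v → (Adj G u v ⇔ (∃ λ p → p ∈Seg σ u × p ∈Seg σ v)))

{-# OPTIONS --safe #-}

-- Draw the faces one after the other along the weak dual.  The part drawn so far lies
-- in a box, except that the two ends of the edge shared with the next face leave the
-- box as perpendicular rays.  A face with at least four corners is drawn around a
-- corner of the box, and again ends in a pair of rays crossing at a point that lies on
-- no other segment.  Consecutive triangles are drawn collinearly, as an interval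
-- graph; only the newest vertex of such a run may turn, which makes the rays
-- perpendicular again.  On the combinatorial side, the edge shared by two consecutive
-- faces separates all earlier faces from the next one, so a new corner has no
-- neighbours among the old vertices off that edge, and biconnectedness puts every
-- vertex on some bounded face.
module Submission where

open import Defs
open import Data.Bool using (true)
import Data.Bool.Properties as Bool
open import Data.Empty using (⊥; ⊥-elim)
open import Data.Fin as Fin using (Fin; toℕ)
import Data.Fin.Properties as Fin
open import Data.Fin.Subset using (Subset; _∈_; ∣_∣; _∉_; ⁅_⁆; _-_; _∪_; ⊤)
import Data.Fin.Subset.Properties as Subset
open import Data.Integer as ℤ using (ℤ; 0ℤ; -_)
import Data.Integer.Properties as ℤ
open import Data.List using (List; []; _∷_; map; length; allFin)
open import Data.List.Membership.Propositional using () renaming (_∈_ to _∈ˡ_)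
open import Data.List.Membership.Propositional.Properties using (∈-allFin; ∈-map⁻)
open import Data.List.Properties using (map-∘)
open import Data.List.Relation.Unary.All as All using (All; []; _∷_)
import Data.List.Relation.Unary.All.Properties as All
open import Data.List.Relation.Unary.AllPairs as AllPairs using (AllPairs; []; _∷_)
import Data.List.Relation.Unary.AllPairs.Properties as AllPairs
open import Data.List.Relation.Unary.Any using (here; there)
open import Data.Nat as ℕ using (ℕ; zero; suc; _+_; z≤n; s≤s)
import Data.Nat.Properties as ℕ
open import Data.Product using (Σ; ∃; _×_; _,_; proj₁; proj₂; map₂)
open import Data.Sum as Sum using (_⊎_; inj₁; inj₂)
open import Data.Vec using (tabulate)
import Data.Vec.Properties as Vec
open import Function using (_∘_; flip)
open import Function.Bundles using (_⇔_; mk⇔; module Equivalence)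
open import Function.Definitions using (Injective)
open import Relation.Binary using (tri<; tri≈; tri>)
open import Relation.Binary.PropositionalEquality using (_≡_; _≢_; refl; trans; cong; subst; subst₂; ≢-sym) renaming (sym to ≡-sym)
open import Relation.Nullary using (¬_; Dec; yes; no; does)
open import Relation.Nullary.Decidable using (_×-dec_; _⊎-dec_; ¬?; dec-true)

open Equivalence using (to; from)

-- Axis-parallel segments have the Helly property: three that meet pairwise share a point. So the
-- new vertex of a triangle must pass through a common point of the two frontier vertices, and that
-- point then also lies on the vertex that is dropped. This is why triangles cannot be drawn like
-- longer faces, and why a drawing has to record which part of the frontier rays is still free. The
-- run continues because a ray that starts at the occupied point can be laid along the other ray
-- without changing any adjacency. A longer face needs only that the frontier leaves the box as two
-- rays, so it restores the free situation whatever came before.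

both-false : ∀ {P Q : Set} → ¬ P → ¬ Q → P ⇔ Q
both-false ¬p ¬q = mk⇔ (⊥-elim ∘ ¬p) (⊥-elim ∘ ¬q)

both-true : ∀ {P Q : Set} → P → Q → P ⇔ Q
both-true p q = mk⇔ (λ _ → q) (λ _ → p)

-- Segments, rays, boxes and symmetries of the plane

Point : Set
Point = ℤ × ℤ

Hits : Seg → (Point → Set) → Set
Hits s R = ∃ λ p → p ∈Seg s × R p

Meets : Seg → Seg → Set
Meets s t = Hits s (_∈Seg t)

Rightward Upward : ℤ → ℤ → Point → Set
Rightward x₀ y₀ (x , y) = y ≡ y₀ × x₀ ℤ.≤ x
Upward    x₀ y₀ (x , y) = x ≡ x₀ × y₀ ℤ.≤ y

Within : ℤ → ℤ → Set
Within B x = - B ℤ.≤ x × x ℤ.≤ B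

Bounded : ℤ → Seg → Set
Bounded B s = ∀ {x y} → (x , y) ∈Seg s → Within B x × Within B y

≤-suc : ∀ {i j} → i ℤ.≤ j → i ℤ.≤ ℤ.suc j
≤-suc = ℤ.i≤j⇒i≤1+j

suc≰ : ∀ {i j} → i ℤ.≤ j → ¬ (ℤ.suc j ℤ.≤ i)
suc≰ i≤j j<i = ℤ.<-irrefl refl (ℤ.≤-<-trans i≤j (ℤ.suc[i]≤j⇒i<j j<i))

within-suc : ∀ {B x} → Within B x → Within (ℤ.suc B) x
within-suc {B} (l , h) = ℤ.≤-trans (ℤ.neg-mono-≤ (ℤ.i≤suc[i] B)) l , ≤-suc h

within-top : ∀ {B x} → Within B x → Within (ℤ.suc B) (ℤ.suc B)
within-top w = let (l , h) = within-suc w in ℤ.≤-trans l h , ℤ.≤-refl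

within-neg : ∀ {B x} → Within B x → Within B (- x)
within-neg {B} {x} (l , h) =
  ℤ.neg-mono-≤ h , subst (- x ℤ.≤_) (ℤ.neg-involutive B) (ℤ.neg-mono-≤ l)

within-between : ∀ {B l h x} → Within B l → Within B h → l ℤ.≤ x → x ℤ.≤ h → Within B x
within-between (p , _) (_ , q) l≤x x≤h = ℤ.≤-trans p l≤x , ℤ.≤-trans x≤h q

hor-bounded : ∀ {B y l h} → Within B y → Within B l → Within B h → Bounded B (hor y l h)
hor-bounded wy wl wh (refl , l≤x , x≤h) = within-between wl wh l≤x x≤h , wy

ver-bounded : ∀ {B x l h} → Within B x → Within B l → Within B h → Bounded B (ver x l h)
ver-bounded wx wl wh (refl , l≤y , y≤h) = wx , within-between wl wh l≤y y≤h

bounded-suc : ∀ {B} s → Bounded B s → Bounded (ℤ.suc B) s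
bounded-suc s bd p∈s = let (wx , wy) = bd p∈s in within-suc wx , within-suc wy

transpose : Seg → Seg
transpose (hor y l h) = ver y l h
transpose (ver x l h) = hor x l h

∈-transpose : ∀ s {x y} → (x , y) ∈Seg s → (y , x) ∈Seg transpose s
∈-transpose (hor _ _ _) p = p
∈-transpose (ver _ _ _) p = p

∈-transpose⁻ : ∀ s {x y} → (x , y) ∈Seg transpose s → (y , x) ∈Seg s
∈-transpose⁻ (hor _ _ _) p = p
∈-transpose⁻ (ver _ _ _) p = p

flip-≤ : ∀ {i j} → - i ℤ.≤ j → - j ℤ.≤ i
flip-≤ {i} {j} p = subst (- j ℤ.≤_) (ℤ.neg-involutive i) (ℤ.neg-mono-≤ p)

flip-≥ : ∀ {i j} → i ℤ.≤ - j → j ℤ.≤ - i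
flip-≥ {i} {j} p = subst (ℤ._≤ - i) (ℤ.neg-involutive j) (ℤ.neg-mono-≤ p)

flip-≡ : ∀ {i j} → i ≡ - j → - i ≡ j
flip-≡ {j = j} refl = ℤ.neg-involutive j

reflect : Seg → Seg
reflect (hor y l h) = hor (- y) l h
reflect (ver x l h) = ver x (- h) (- l)

∈-reflect : ∀ s {x y} → (x , y) ∈Seg s → (x , - y) ∈Seg reflect s
∈-reflect (hor _ _ _) (e , l , h) = cong -_ e , l , h
∈-reflect (ver _ _ _) (e , l , h) = e , ℤ.neg-mono-≤ h , ℤ.neg-mono-≤ l

∈-reflect⁻ : ∀ s {x y} → (x , y) ∈Seg reflect s → (x , - y) ∈Seg s
∈-reflect⁻ (hor _ _ _) (e , l , h) = flip-≡ e , l , h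
∈-reflect⁻ (ver _ _ _) (e , l , h) = e , flip-≥ h , flip-≤ l

reflect-bounded : ∀ {B} s → Bounded B s → Bounded B (reflect s)
reflect-bounded s bd {y = y} p =
  let (wx , wy) = bd (∈-reflect⁻ s p) in
  wx , subst (Within _) (ℤ.neg-involutive y) (within-neg wy)

-- The relation `_R_` decides whether the corner `(x₀ , y₀)` itself is forbidden: it is for `ℤ._≤_`,
-- and it is not for `ℤ._<_`.
Avoids : (ℤ → ℤ → Set) → ℤ → ℤ → Seg → Set
Avoids _R_ x₀ y₀ s =
  ∀ x y → (x , y) ∈Seg s → ¬ (y ≡ y₀ × x₀ R x) × ¬ (x ≡ x₀ × y₀ R y)

avoids-transpose : ∀ s {_R_ x₀ y₀} → Avoids _R_ x₀ y₀ s → Avoids _R_ y₀ x₀ (transpose s)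
avoids-transpose s av x y p = let (q , r) = av y x (∈-transpose⁻ s p) in r , q

avoids-weaken : ∀ s {x₀ y₀} → Avoids ℤ._≤_ x₀ y₀ s → Avoids ℤ._<_ x₀ y₀ s
avoids-weaken s av x y p = let (q , r) = av x y p in
  (λ (e , l) → q (e , ℤ.<⇒≤ l)) , λ (e , l) → r (e , ℤ.<⇒≤ l)

-- Partial drawings with two open rays, and the ways to extend them

module Drawing (V : Set) (_~_ : V → V → Set) (~-sym : ∀ {u v} → u ~ v → v ~ u) where

  ≁-flip : ∀ {u v} → ¬ (u ~ v) → ¬ (v ~ u)
  ≁-flip n = n ∘ ~-sym

  Compatible : V × Seg → V × Seg → Set
  Compatible (u , s) (v , t) = (u ~ v) ⇔ Meets s t

  compatible-sym : ∀ {e f} → Compatible e f → Compatible f e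
  compatible-sym c = mk⇔
    (λ vu → let (p , q , r) = to c (~-sym vu) in p , r , q)
    (λ (p , q , r) → ~-sym (from c (p , r , q)))

  record Settled (B : ℤ) (a : V) (A : Point → Set) (b : V) (U : Point → Set)
                 (e : V × Seg) : Set where
    constructor settled
    private
      w = proj₁ e
      s = proj₂ e
    field
      nonempty : NonEmpty s
      bounded  : Bounded B s
      meetsA   : (w ~ a) ⇔ Hits s A
      meetsB   : (w ~ b) ⇔ Hits s U

  -- The vertices vs are drawn for good.  The frontier vertex a is drawn as a
  -- rightward ray and b as an upward ray; both will be cut outside the box
  -- [-B, B]² that contains everything else.
  record Open (vs : List V) (a b : V) : Set where
    constructor open′
    field
      {fixed}       : List (V × Seg)
      {B}           : ℤ
      {xa ya xb yb} : ℤ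
      names         : map proj₁ fixed ≡ vs
      xa-in         : Within B xa
      ya-in         : Within B ya
      xb-in         : Within B xb
      yb-in         : Within B yb
      pairs         : AllPairs Compatible fixed
      settle        : All (Settled B a (Rightward xa ya) b (Upward xb yb)) fixed
      a~b           : (a ~ b) ⇔ (xa ℤ.≤ xb × yb ℤ.≤ ya)

  module _ {vs a b} (o : Open vs a b) where
    open Open o

    -- The cut lies one unit outside the box, so its end is on no fixed segment and a new vertex can
    -- be attached there.
    cutA : V × Seg
    cutA = a , hor ya xa (ℤ.suc B)

    cutB : V × Seg
    cutB = b , ver xb yb (ℤ.suc B)

    cutA-fixed : All (Compatible cutA) fixed
    cutA-fixed = All.map
      (λ { (settled _ bd mA _) → mk⇔
           (λ a~w → let ((x , y) , p∈s , e , l) = to mA (~-sym a~w) in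
                    (x , y) , (e , l , ≤-suc (proj₂ (proj₁ (bd p∈s)))) , p∈s)
           (λ { (p , (e , l , _) , p∈s) → ~-sym (from mA (p , p∈s , e , l)) }) })
      settle

    cutB-fixed : All (Compatible cutB) fixed
    cutB-fixed = All.map
      (λ { (settled _ bd _ mB) → mk⇔
           (λ b~w → let ((x , y) , p∈s , e , l) = to mB (~-sym b~w) in
                    (x , y) , (e , l , ≤-suc (proj₂ (proj₂ (bd p∈s)))) , p∈s)
           (λ { (p , (e , l , _) , p∈s) → ~-sym (from mB (p , p∈s , e , l)) }) })
      settle

    cutA-bounded : Bounded (ℤ.suc B) (proj₂ cutA)
    cutA-bounded = hor-bounded (within-suc ya-in) (within-suc xa-in) (within-top xa-in)

    cutB-bounded : Bounded (ℤ.suc B) (proj₂ cutB)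
    cutB-bounded = ver-bounded (within-suc xb-in) (within-suc yb-in) (within-top yb-in)

    cutA-end : (ℤ.suc B , ya) ∈Seg proj₂ cutA
    cutA-end = refl , ≤-suc (proj₂ xa-in) , ℤ.≤-refl

    cutB-end : (xb , ℤ.suc B) ∈Seg proj₂ cutB
    cutB-end = refl , ≤-suc (proj₂ yb-in) , ℤ.≤-refl

    cutA-b : (a ~ b) ⇔ Hits (proj₂ cutA) (Upward xb yb)
    cutA-b = mk⇔
      (λ ab → let (l , h) = to a~b ab in
              (xb , ya) , (refl , l , ≤-suc (proj₂ xb-in)) , refl , h)
      (λ { (_ , (refl , l , _) , refl , h) → from a~b (l , h) })

    cutB-a : (b ~ a) ⇔ Hits (proj₂ cutB) (Rightward xa ya)
    cutB-a = mk⇔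
      (λ ba → let (l , h) = to a~b (~-sym ba) in
              (xb , ya) , (refl , h , ≤-suc (proj₂ ya-in)) , refl , l)
      (λ { (_ , (refl , h , _) , refl , l) → ~-sym (from a~b (l , h)) })

    cutA-cutB : Compatible cutA cutB
    cutA-cutB = mk⇔
      (λ ab → let (l , h) = to a~b ab in (xb , ya) ,
              (refl , l , ≤-suc (proj₂ xb-in)) , (refl , h , ≤-suc (proj₂ ya-in)))
      (λ { (_ , (refl , l , _) , (refl , h , _)) → from a~b (l , h) })

    map-settled : ∀ {N : V → Set} {P Q : V × Seg → Set} →
                  All N vs → All P fixed →
                  (∀ {e} → N (proj₁ e) → P e → Q e) → All Q fixed
    map-settled av ap f =
      All.zipWith (λ (x , y) → f x y)
        (All.map⁻ (subst (All _) (≡-sym names) av) , ap)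

  -- Transposing the plane exchanges the rightward and the upward ray, so a construction has to be
  -- carried out for one frontier vertex only.
  swap-open : ∀ {vs a b} → Open vs a b → Open vs b a
  swap-open {a = a} {b} o = open′
    (trans (≡-sym (map-∘ fixed)) names) yb-in xb-in ya-in xa-in
    (AllPairs.map⁺ (AllPairs.map (λ {e} {f} c → compat {e} {f} c) pairs))
    (All.map⁺ (All.map (λ {e} → sett {e}) settle))
    (mk⇔ (λ ba → let (l , h) = to a~b (~-sym ba) in h , l)
         (λ (l , h) → ~-sym (from a~b (h , l))))
    where
    open Open o
    compat : ∀ {e f} → Compatible e f → Compatible (map₂ transpose e) (map₂ transpose f)
    compat {_ , s} {_ , t} c = mk⇔
      (λ uv → let ((x , y) , p , q) = to c uv in (y , x) , ∈-transpose s p , ∈-transpose t q)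
      (λ { ((x , y) , p , q) → from c ((y , x) , ∈-transpose⁻ s p , ∈-transpose⁻ t q) })
    sett : ∀ {e} → Settled B a (Rightward xa ya) b (Upward xb yb) e →
           Settled B b (Rightward yb xb) a (Upward ya xa) (map₂ transpose e)
    sett {_ , s} (settled ((x , y) , p∈) bd mA mB) = settled
      ((y , x) , ∈-transpose s p∈)
      (λ p → let (wx , wy) = bd (∈-transpose⁻ s p) in wy , wx)
      (mk⇔ (λ adj → let ((x , y) , p , e , l) = to mB adj in (y , x) , ∈-transpose s p , e , l)
           (λ { ((x , y) , p , e , l) → from mB ((y , x) , ∈-transpose⁻ s p , e , l) }))
      (mk⇔ (λ adj → let ((x , y) , p , e , l) = to mA adj in (y , x) , ∈-transpose s p , e , l)
           (λ { ((x , y) , p , e , l) → from mA ((y , x) , ∈-transpose⁻ s p , e , l) }))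

  -- `v` continues the ray of `a` from its cut end. It starts to the right of the box, so it misses
  -- the older segments and also the upward ray of `b`, whose abscissa is at most `B`.
  extendA : ∀ {vs a b v} → Open vs a b → All (λ w → ¬ (w ~ v)) vs →
            a ~ v → ¬ (v ~ b) → Open (a ∷ vs) v b
  extendA {a = a} {b} {v} o fresh av v≁b = open′
    {fixed = cutA o ∷ fixed} {ℤ.suc B} {ℤ.suc B} {ya} {xb} {yb}
    (cong (_ ∷_) names)
    (within-top xa-in) (within-suc ya-in) (within-suc xb-in) (within-suc yb-in)
    (cutA-fixed o ∷ pairs)
    (settled (_ , cutA-end o) (cutA-bounded o)
             (both-true av (_ , cutA-end o , refl , ℤ.≤-refl)) (cutA-b o)
      ∷ map-settled o fresh settle (λ {e} → old {e}))
    (both-false v≁b (λ (l , _) → suc≰ (proj₂ xb-in) l))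
    where
    open Open o
    old : ∀ {e} → ¬ (proj₁ e ~ v) → Settled B a (Rightward xa ya) b (Upward xb yb) e →
          Settled (ℤ.suc B) v (Rightward (ℤ.suc B) ya) b (Upward xb yb) e
    old {_ , s} w≁v (settled ne bd mA mB) = settled ne (bounded-suc s bd)
      (both-false w≁v λ { (_ , p∈s , _ , l) → suc≰ (proj₂ (proj₁ (bd p∈s))) l }) mB

  extendB : ∀ {vs a b v} → Open vs a b → All (λ w → ¬ (w ~ v)) vs →
            b ~ v → ¬ (v ~ a) → Open (b ∷ vs) a v
  extendB o fresh bv v≁a = swap-open (extendA (swap-open o) fresh bv v≁a)

  -- The rays of a and b cross at (xb , ya).  Either no fixed segment meets them
  -- from there on, or none does strictly beyond, and one of the two rays starts
  -- at the crossing, so that it may be turned to run along the other one.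
  data Mode {vs a b} (o : Open vs a b) : Set where
    clean : let open Open o in
            All (Avoids ℤ._≤_ xb ya ∘ proj₂) fixed → Mode o
    pendA : let open Open o in
            xa ≡ xb → All (Avoids ℤ._<_ xb ya ∘ proj₂) fixed → Mode o
    pendB : let open Open o in
            yb ≡ ya → All (Avoids ℤ._<_ xb ya ∘ proj₂) fixed → Mode o

  record Rung (vs : List V) (a b : V) : Set where
    constructor rung
    field
      base  : Open vs a b
      a-b   : a ~ b
      mode  : Mode base

  transposed : ∀ _R_ {x₀ y₀} {es : List (V × Seg)} → All (Avoids _R_ x₀ y₀ ∘ proj₂) es →
               All (Avoids _R_ y₀ x₀ ∘ proj₂) (map (map₂ transpose) es)
  transposed _ = All.map⁺ ∘ All.map (λ {e} → avoids-transpose (proj₂ e))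

  swap : ∀ {vs a b} → Rung vs a b → Rung vs b a
  swap (rung o ab m) = rung (swap-open o) (~-sym ab) (mode′ m)
    where
    open Open o
    mode′ : Mode o → Mode (swap-open o)
    mode′ (clean f)   = clean (transposed ℤ._≤_ f)
    mode′ (pendA q f) = pendB q (transposed ℤ._<_ f)
    mode′ (pendB q f) = pendA q (transposed ℤ._<_ f)

  start : ∀ {a b} → a ~ b → Rung [] a b
  start ab = rung
    (open′ {fixed = []} {0ℤ} {0ℤ} {0ℤ} {0ℤ} {0ℤ} refl z z z z [] []
           (both-true ab (ℤ.≤-refl , ℤ.≤-refl)))
    ab (clean [])
    where z : Within 0ℤ 0ℤ
          z = ℤ.≤-refl , ℤ.≤-refl

  -- `v` rises from the end of `a` along the right side of the enlarged box, and `w` runs rightward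
  -- from the end of `b` along its top. They cross at the top right corner, which no fixed segment
  -- reaches.
  bend : ∀ {vs a b v w} → Open vs a b →
         All (λ z → ¬ (z ~ v)) vs → All (λ z → ¬ (z ~ w)) vs →
         a ~ v → b ~ w → v ~ w → ¬ (a ~ w) → ¬ (b ~ v) → Rung (b ∷ a ∷ vs) w v
  bend {a = a} {b} {v} {w} o fresh-v fresh-w av bw vw a≁w b≁v = rung
    (open′ {fixed = cutB o ∷ cutA o ∷ fixed} {ℤ.suc B} {xb} {ℤ.suc B} {ℤ.suc B} {ya}
      (cong (λ l → b ∷ a ∷ l) names)
      (within-suc xb-in) (within-top xa-in) (within-top xa-in) (within-suc ya-in)
      ((flipped ∷ cutB-fixed o) ∷ cutA-fixed o ∷ pairs)
      (settled (_ , cutB-end o) (cutB-bounded o)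
               (both-true bw (_ , cutB-end o , refl , ℤ.≤-refl))
               (both-false b≁v λ { (_ , (refl , _) , e , _) → xb≢ e })
       ∷ settled (_ , cutA-end o) (cutA-bounded o)
               (both-false a≁w λ { (_ , (refl , _) , e , _) → ya≢ e })
               (both-true av (_ , cutA-end o , refl , ℤ.≤-refl))
       ∷ map-settled o (All.zip (fresh-v , fresh-w)) settle (λ {e} → old {e}))
      (both-true (~-sym vw) (≤-suc (proj₂ xb-in) , ≤-suc (proj₂ ya-in))))
    (~-sym vw)
    (clean ((λ { _ _ (refl , _) → (λ (_ , l) → suc≰ (proj₂ xb-in) l) , λ (e , _) → xb≢ e })
          ∷ (λ { _ _ (refl , _) → (λ (e , _) → ya≢ e) , λ (_ , l) → suc≰ (proj₂ ya-in) l })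
          ∷ All.map (λ st x y p∈s → let ((_ , hx) , (_ , hy)) = Settled.bounded st p∈s in
                       (λ (_ , l) → suc≰ hx l) , λ (_ , l) → suc≰ hy l) settle))
    where
    open Open o
    xb≢ : xb ≢ ℤ.suc B
    xb≢ e = suc≰ (proj₂ xb-in) (ℤ.≤-reflexive (≡-sym e))
    ya≢ : ya ≢ ℤ.suc B
    ya≢ e = suc≰ (proj₂ ya-in) (ℤ.≤-reflexive (≡-sym e))
    flipped : Compatible (cutB o) (cutA o)
    flipped = compatible-sym {cutA o} {cutB o} (cutA-cutB o)
    old : ∀ {e} → (¬ (proj₁ e ~ v)) × (¬ (proj₁ e ~ w)) →
          Settled B a (Rightward xa ya) b (Upward xb yb) e →
          Settled (ℤ.suc B) w (Rightward xb (ℤ.suc B)) v (Upward (ℤ.suc B) ya) e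
    old {_ , s} (z≁v , z≁w) (settled ne bd _ _) = settled ne (bounded-suc s bd)
      (both-false z≁w λ { (_ , p∈s , refl , _) → suc≰ (proj₂ (proj₂ (bd p∈s))) ℤ.≤-refl })
      (both-false z≁v λ { (_ , p∈s , refl , _) → suc≰ (proj₂ (proj₁ (bd p∈s))) ℤ.≤-refl })

  -- The path b, c, d is drawn around the top right corner of the box, and d
  -- leaves the box at the bottom; reflecting makes it leave at the top.
  hook : ∀ {vs a b c d} → Open vs a b →
         All (λ z → ¬ (z ~ c)) vs → All (λ z → ¬ (z ~ d)) vs →
         b ~ c → c ~ d → a ~ d → ¬ (a ~ c) → ¬ (b ~ d) → Rung (c ∷ b ∷ vs) a d
  hook {a = a} {b} {c} {d} o fresh-c fresh-d bc cd ad a≁c b≁d = rung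
    -- In reflected coordinates `a` runs at height `- ya`, and `d` rises from the lower right
    -- corner, where `segC` ends; they cross at `(ℤ.suc B , - ya)`.
    (open′ {fixed = (c , segC) ∷ map (map₂ reflect) (cutB o ∷ fixed)}
           {ℤ.suc B} {xa} { - ya} {ℤ.suc B} { - ℤ.suc B}
      (cong (λ l → c ∷ b ∷ l) (trans (≡-sym (map-∘ fixed)) names))
      (within-suc xa-in) (within-suc (within-neg ya-in))
      top (within-neg top)
      ((both-true (~-sym bc) (_ , c-start , b-end)
        ∷ All.map⁺ (map-settled o fresh-c settle (λ {e} → c-old {e})))
       ∷ AllPairs.map⁺ {f = map₂ reflect} (AllPairs.map (λ {e} {f} → compat {e} {f}) (cutB-fixed o ∷ pairs)))
      (settled (_ , c-start) (hor-bounded (within-neg top) (within-suc xb-in) top)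
         (both-false (≁-flip a≁c) λ { (_ , (refl , _) , e , _) → ya≢ (ℤ.neg-injective e) })
         (both-true cd (_ , c-end , refl , ℤ.≤-refl))
       ∷ settled (_ , b-end) (λ p → cut-reflect p)
         (rightward-reflect (proj₂ (cutB o)) (cutB-a o))
         (both-false b≁d λ { (_ , (refl , _) , e , _) → xb≢ e })
       ∷ All.map⁺ (map-settled o fresh-d settle (λ {e} → old {e})))
      (both-true ad (≤-suc (proj₂ xa-in) , ℤ.neg-mono-≤ (≤-suc (proj₂ ya-in)))))
    ad
    (clean ((λ { _ _ (refl , _) → (λ (e , _) → ya≢ (ℤ.neg-injective e))
                               , λ (_ , l) → suc≰ (proj₂ ya-in) (neg-cancel l) })
          ∷ (λ { _ _ (refl , _) → (λ (_ , l) → suc≰ (proj₂ xb-in) l) , λ (e , _) → xb≢ e })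
          ∷ All.map⁺ (All.map (λ {e} st x y p∈ →
              let ((_ , hx) , _) = Settled.bounded st (∈-reflect⁻ (proj₂ e) p∈) in
              (λ (_ , l) → suc≰ hx l) , λ (e , _) → suc≰ hx (ℤ.≤-reflexive (≡-sym e))) settle)))
    where
    open Open o
    top : Within (ℤ.suc B) (ℤ.suc B)
    top = within-top xa-in
    segC : Seg
    segC = hor (- ℤ.suc B) xb (ℤ.suc B)
    c-start : (xb , - ℤ.suc B) ∈Seg segC
    c-start = refl , ℤ.≤-refl , ≤-suc (proj₂ xb-in)
    c-end : (ℤ.suc B , - ℤ.suc B) ∈Seg segC
    c-end = refl , ≤-suc (proj₂ xb-in) , ℤ.≤-refl
    b-end : (xb , - ℤ.suc B) ∈Seg reflect (proj₂ (cutB o))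
    b-end = ∈-reflect (proj₂ (cutB o)) (cutB-end o)
    xb≢ : xb ≢ ℤ.suc B
    xb≢ e = suc≰ (proj₂ xb-in) (ℤ.≤-reflexive (≡-sym e))
    ya≢ : ℤ.suc B ≢ ya
    ya≢ e = suc≰ (proj₂ ya-in) (ℤ.≤-reflexive e)
    neg-cancel : ∀ {i j} → - i ℤ.≤ - j → j ℤ.≤ i
    neg-cancel {i} l = subst (_ ℤ.≤_) (ℤ.neg-involutive i) (flip-≥ l)
    cut-reflect : Bounded (ℤ.suc B) (reflect (proj₂ (cutB o)))
    cut-reflect = reflect-bounded (proj₂ (cutB o)) (cutB-bounded o)
    c-old : ∀ {e} → ¬ (proj₁ e ~ c) → Settled B a (Rightward xa ya) b (Upward xb yb) e →
            Compatible (c , segC) (map₂ reflect e)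
    c-old {_ , s} z≁c st = both-false (≁-flip z≁c) λ { ((x , _) , (refl , _) , p∈) →
      suc≰ (proj₂ (proj₂ (Settled.bounded st (∈-reflect⁻ s p∈))))
           (ℤ.≤-reflexive (≡-sym (ℤ.neg-involutive (ℤ.suc B)))) }
    compat : ∀ {e f} → Compatible e f → Compatible (map₂ reflect e) (map₂ reflect f)
    compat {_ , s} {_ , t} m = mk⇔
      (λ uv → let ((x , y) , p , q) = to m uv in (x , - y) , ∈-reflect s p , ∈-reflect t q)
      (λ { ((x , y) , p , q) → from m ((x , - y) , ∈-reflect⁻ s p , ∈-reflect⁻ t q) })
    rightward-reflect : ∀ {P : Set} s → P ⇔ Hits s (Rightward xa ya) →
                        P ⇔ Hits (reflect s) (Rightward xa (- ya))
    rightward-reflect s m = mk⇔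
      (λ p → let ((x , y) , q , e , l) = to m p in (x , - y) , ∈-reflect s q , cong -_ e , l)
      (λ { ((x , y) , q , e , l) → from m ((x , - y) , ∈-reflect⁻ s q , flip-≡ e , l) })
    old : ∀ {e} → ¬ (proj₁ e ~ d) → Settled B a (Rightward xa ya) b (Upward xb yb) e →
          Settled (ℤ.suc B) a (Rightward xa (- ya)) d (Upward (ℤ.suc B) (- ℤ.suc B)) (map₂ reflect e)
    old {_ , s} z≁d (settled (_ , p∈) bd mA _) = settled
      (_ , ∈-reflect s p∈) (bounded-suc (reflect s) (reflect-bounded s bd))
      (rightward-reflect s mA)
      (both-false z≁d λ { (_ , p∈′ , refl , _) →
         suc≰ (proj₂ (proj₁ (bd (∈-reflect⁻ s p∈′)))) ℤ.≤-refl })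

  module _ {vs a b v} (o : Open vs a b) (fresh : All (λ z → ¬ (z ~ v)) vs)
           (ab : a ~ b) (av : a ~ v) (bv : b ~ v) where
    open Open o
    private
      xa≤xb : xa ℤ.≤ xb
      xa≤xb = proj₁ (to a~b ab)
      yb≤ya : yb ℤ.≤ ya
      yb≤ya = proj₂ (to a~b ab)

    -- `b` stops at the crossing and `v` takes over the rest of its ray, on which no fixed segment
    -- meets `b` by cleanness. The crossing now lies on the settled `b`, hence the weaker mode
    -- `pendB`.
    fan-clean : All (Avoids ℤ._≤_ xb ya ∘ proj₂) fixed → Rung (b ∷ vs) a v
    fan-clean cl = rung
      (open′ {fixed = (b , ver xb yb ya) ∷ fixed} {B} {xa} {ya} {xb} {ya}
        (cong (b ∷_) names) xa-in ya-in xb-in ya-in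
        (All.zipWith (λ {e} (c , st) → b-old {e} c st) (cl , settle) ∷ pairs)
        (settled (_ , crossing) (ver-bounded xb-in yb-in ya-in)
           (both-true (~-sym ab) (_ , crossing , refl , xa≤xb))
           (both-true bv (_ , crossing , refl , ℤ.≤-refl))
         ∷ map-settled o fresh (All.zip (cl , settle)) (λ {e} → old {e}))
        (both-true av (xa≤xb , ℤ.≤-refl)))
      av
      (pendB refl ((λ { _ _ (refl , _ , h) → (λ (_ , l) → ℤ.<-irrefl refl l)
                                          , λ (_ , l) → ℤ.<⇒≱ l h })
                  ∷ All.map (λ {e} → avoids-weaken (proj₂ e)) cl))
      where
      crossing : (xb , ya) ∈Seg ver xb yb ya
      crossing = refl , yb≤ya , ℤ.≤-refl
      b-old : ∀ {e} → Avoids ℤ._≤_ xb ya (proj₂ e) →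
              Settled B a (Rightward xa ya) b (Upward xb yb) e → Compatible (b , ver xb yb ya) e
      b-old {_ , s} c st = mk⇔
        (λ bw → let ((x , y) , p , e , l) = to (Settled.meetsB st) (~-sym bw) in
                (x , y) , (e , l , ℤ.≮⇒≥ λ h → proj₂ (c x y p) (e , ℤ.<⇒≤ h)) , p)
        (λ { (p , (e , l , _) , p∈s) → ~-sym (from (Settled.meetsB st) (p , p∈s , e , l)) })
      old : ∀ {e} → ¬ (proj₁ e ~ v) →
            Avoids ℤ._≤_ xb ya (proj₂ e) × Settled B a (Rightward xa ya) b (Upward xb yb) e →
            Settled B a (Rightward xa ya) v (Upward xb ya) e
      old z≁v (c , settled ne bd mA _) = settled ne bd mA
        (both-false z≁v λ { ((x , y) , p , q) → proj₂ (c x y p) q })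

    module _ (yb≡ya : yb ≡ ya) (cl : All (Avoids ℤ._<_ xb ya ∘ proj₂) fixed) where

      private
        beyond : ∀ {f} → All (λ e → Avoids ℤ._<_ (ℤ.suc B) ya (proj₂ e)) fixed →
                 (∀ {x y} → (x , y) ∈Seg proj₂ f → x ℤ.≤ ℤ.suc B × y ≡ ya) →
                 All (Avoids ℤ._<_ (ℤ.suc B) ya ∘ proj₂) (f ∷ fixed)
        beyond rest h =
          (λ x y p → let (x≤ , y≡) = h p in
             (λ (_ , l) → ℤ.<⇒≱ l x≤) , λ (_ , l) → ℤ.<-irrefl (≡-sym y≡) l)
          ∷ rest

        outside : All (λ e → Avoids ℤ._<_ (ℤ.suc B) ya (proj₂ e)) fixed
        outside = All.map (λ st x y p → let ((_ , hx) , _) = Settled.bounded st p in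
            (λ (_ , l) → suc≰ hx (ℤ.<⇒≤ l))
          , λ (e , _) → suc≰ hx (ℤ.≤-reflexive (≡-sym e))) settle

        -- The upward ray of `b` starts at the crossing, and a fixed segment can meet it only there;
        -- the same holds for the rightward ray from the crossing. Turning `b` therefore preserves
        -- its adjacencies.
        turned : ∀ {e} → Avoids ℤ._<_ xb ya (proj₂ e) →
                 Settled B a (Rightward xa ya) b (Upward xb yb) e →
                 (proj₁ e ~ b) ⇔ Hits (proj₂ e) (Rightward xb ya)
        turned c (settled _ _ _ mB) = mk⇔
          (λ wb → let ((x , y) , p , e , l) = to mB wb in
             (x , y) , p ,
             ℤ.≤-antisym (ℤ.≮⇒≥ λ h → proj₂ (c x y p) (e , h)) (subst (ℤ._≤ y) yb≡ya l) ,
             ℤ.≤-reflexive (≡-sym e))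
          (λ { ((x , y) , p , e , l) → from mB ((x , y) , p ,
             ℤ.≤-antisym (ℤ.≮⇒≥ λ h → proj₁ (c x y p) (e , h)) l ,
             ℤ.≤-reflexive (trans yb≡ya (≡-sym e))) })

        far : ∀ {e} → ¬ (proj₁ e ~ v) → Bounded B (proj₂ e) →
              (proj₁ e ~ v) ⇔ Hits (proj₂ e) (Upward (ℤ.suc B) ya)
        far z≁v bd = both-false z≁v λ { (_ , p , e , _) →
          suc≰ (proj₂ (proj₁ (bd p))) (ℤ.≤-reflexive (≡-sym e)) }

      -- `b` turns onto the line of `a`, overlaps it, and stops outside the old box. From that end
      -- `v` rises as a ray perpendicular to `a`, and may itself turn later.
      fan-keep-a : Rung (b ∷ vs) a v
      fan-keep-a = rung
        (open′ {fixed = (b , segB) ∷ fixed} {ℤ.suc B} {xa} {ya} {ℤ.suc B} {ya}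
          (cong (b ∷_) names)
          (within-suc xa-in) (within-suc ya-in) (within-top xa-in) (within-suc ya-in)
          (All.zipWith (λ {e} (c , st) → b-old {e} c st) (cl , settle) ∷ pairs)
          (settled (_ , b-end)
             (hor-bounded (within-suc ya-in) (within-suc xb-in) (within-top xa-in))
             (both-true (~-sym ab) (_ , b-end , refl , ≤-suc (proj₂ xa-in)))
             (both-true bv (_ , b-end , refl , ℤ.≤-refl))
           ∷ map-settled o fresh settle (λ {e} → old {e}))
          (both-true av (≤-suc (proj₂ xa-in) , ℤ.≤-refl)))
        av
        (pendB refl (beyond outside λ { (y≡ , _ , x≤) → x≤ , y≡ }))
        where
        segB : Seg
        segB = hor ya xb (ℤ.suc B)
        b-end : (ℤ.suc B , ya) ∈Seg segB
        b-end = refl , ≤-suc (proj₂ xb-in) , ℤ.≤-refl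
        b-old : ∀ {e} → Avoids ℤ._<_ xb ya (proj₂ e) →
                Settled B a (Rightward xa ya) b (Upward xb yb) e → Compatible (b , segB) e
        b-old {e} c st = mk⇔
          (λ bw → let ((x , y) , p , q , l) = to (turned {e} c st) (~-sym bw) in
             (x , y) , (q , l , ≤-suc (proj₂ (proj₁ (Settled.bounded st p)))) , p)
          (λ { (p , (q , l , _) , p∈) → ~-sym (from (turned {e} c st) (p , p∈ , q , l)) })
        old : ∀ {e} → ¬ (proj₁ e ~ v) → Settled B a (Rightward xa ya) b (Upward xb yb) e →
              Settled (ℤ.suc B) a (Rightward xa ya) v (Upward (ℤ.suc B) ya) e
        old {e} z≁v (settled ne bd mA _) =
          settled ne (bounded-suc (proj₂ e) bd) mA (far {e} z≁v bd)

      -- Now `a` is the one that stops, and the turned `b` replaces it as the rightward ray.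
      fan-keep-b : Rung (a ∷ vs) b v
      fan-keep-b = rung
        (open′ {fixed = cutA o ∷ fixed} {ℤ.suc B} {xb} {ya} {ℤ.suc B} {ya}
          (cong (a ∷_) names)
          (within-suc xb-in) (within-suc ya-in) (within-top xa-in) (within-suc ya-in)
          (cutA-fixed o ∷ pairs)
          (settled (_ , cutA-end o) (cutA-bounded o)
             (both-true ab (_ , cutA-end o , refl , ≤-suc (proj₂ xb-in)))
             (both-true av (_ , cutA-end o , refl , ℤ.≤-refl))
           ∷ map-settled o fresh (All.zip (cl , settle)) (λ {e} → old {e}))
          (both-true bv (≤-suc (proj₂ xb-in) , ℤ.≤-refl)))
        bv
        (pendB refl (beyond outside λ { (y≡ , _ , x≤) → x≤ , y≡ }))
        where
        old : ∀ {e} → ¬ (proj₁ e ~ v) →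
              Avoids ℤ._<_ xb ya (proj₂ e) × Settled B a (Rightward xa ya) b (Upward xb yb) e →
              Settled (ℤ.suc B) b (Rightward xb ya) v (Upward (ℤ.suc B) ya) e
        old {e} z≁v (c , st@(settled ne bd _ _)) =
          settled ne (bounded-suc (proj₂ e) bd) (turned {e} c st) (far {e} z≁v bd)

  -- `a` always survives; keeping `b` is the same statement between two uses of `swap`. In mode
  -- `pendA` it is `a` that turns, so the transposed drawing and `fan-keep-b` apply.
  triangle : ∀ {vs a b v} → Rung vs a b → All (λ z → ¬ (z ~ v)) vs →
             a ~ v → b ~ v → Rung (b ∷ vs) a v
  triangle (rung o ab (clean f)) fresh av bv = fan-clean o fresh ab av bv f
  triangle (rung o ab (pendB q f)) fresh av bv = fan-keep-a o fresh ab av bv q f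
  triangle (rung o ab (pendA q f)) fresh av bv =
    fan-keep-b (swap-open o) fresh (~-sym ab) bv av q (transposed ℤ._<_ f)

  Representation : List V → Set
  Representation vs = Σ (List (V × Seg)) λ es →
    map proj₁ es ≡ vs × All (NonEmpty ∘ proj₂) es × AllPairs Compatible es

  represent : ∀ {vs a b} → Open vs a b → Representation (a ∷ b ∷ vs)
  represent {a = a} {b} o = cutA o ∷ cutB o ∷ fixed , cong (λ l → a ∷ b ∷ l) names ,
    (_ , cutA-end o) ∷ (_ , cutB-end o) ∷ All.map Settled.nonempty settle ,
    (cutA-cutB o ∷ cutA-fixed o) ∷ cutB-fixed o ∷ pairs
    where open Open o

  compatible-entries : ∀ {es e f} → AllPairs Compatible es → e ∈ˡ es → f ∈ˡ es →
                       proj₁ e ≢ proj₁ f → Compatible e f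
  compatible-entries (p ∷ ps) (here refl) (here refl) e≢f = ⊥-elim (e≢f refl)
  compatible-entries (p ∷ ps) (here refl) (there f∈)  _   = All.lookup p f∈
  compatible-entries {e = e} {f} (p ∷ ps) (there e∈) (here refl) _ =
    compatible-sym {f} {e} (All.lookup p e∈)
  compatible-entries (p ∷ ps) (there e∈)  (there f∈)  e≢f = compatible-entries ps e∈ f∈ e≢f

  segments : ∀ {vs} → Representation vs → (∀ v → v ∈ˡ vs) → Σ (V → Seg) λ σ →
             (∀ v → NonEmpty (σ v)) ×
             (∀ u v → u ≢ v → (u ~ v) ⇔ Meets (σ u) (σ v))
  segments (es , refl , nonempty , pairs) all =
    (λ v → proj₂ (proj₁ (entry v))) ,
    (λ v → All.lookup nonempty (proj₁ (proj₂ (entry v)))) ,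
    λ u v u≢v → let (e , e∈ , u≡) = entry u ; (f , f∈ , v≡) = entry v in
      subst₂ (λ u′ v′ → (u′ ~ v′) ⇔ Meets (proj₂ e) (proj₂ f)) (≡-sym u≡) (≡-sym v≡)
        (compatible-entries pairs e∈ f∈ λ q → u≢v (trans u≡ (trans q (≡-sym v≡))))
    where
    entry : ∀ v → ∃ λ e → e ∈ˡ es × v ≡ proj₁ e
    entry v = ∈-map⁻ proj₁ (all v)

-- Drawing one face from its entrance edge to its exit edge

module FaceStep (V : Set) (_~_ : V → V → Set) (~-sym : ∀ {u v} → u ~ v → v ~ u)
  (c : ℕ → V) (last : ℕ)
  (cycle : ∀ {i j} → i ℕ.< j → j ℕ.≤ last → (c i ~ c j) ⇔ (suc i ≡ j ⊎ (i ≡ 0 × j ≡ last)))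
  (vs : List V)
  (apart : ∀ {w k} → w ∈ˡ vs → 0 ℕ.< k → k ℕ.< last → ¬ (w ~ c k)) where

  open Drawing V _~_ ~-sym

  -- The entrance edge joins corners `0` and `last`. The frontier corners `i` and `j` move towards
  -- each other until they form the exit edge, and what lies outside the interval between them is
  -- finished.
  Done : ℕ → ℕ → ℕ → Set
  Done i j k = k ℕ.< i ⊎ (j ℕ.< k × k ℕ.≤ last)

  Drawn : List V → ℕ → ℕ → Set
  Drawn us i j = ∀ w → w ∈ˡ us ⇔ (w ∈ˡ vs ⊎ ∃ λ k → Done i j k × w ≡ c k)

  drawn-left : ∀ {us i j} → Drawn us i j → Drawn (c i ∷ us) (suc i) j
  drawn-left {us} {i} {j} d w = mk⇔ f g
    where
    f : w ∈ˡ c i ∷ us → _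
    f (here w≡)  = inj₂ (i , inj₁ ℕ.≤-refl , w≡)
    f (there w∈) with to (d w) w∈
    ... | inj₁ w∈vs                  = inj₁ w∈vs
    ... | inj₂ (k , inj₁ k<i , w≡)   = inj₂ (k , inj₁ (ℕ.m<n⇒m<1+n k<i) , w≡)
    ... | inj₂ (k , inj₂ j<k , w≡)   = inj₂ (k , inj₂ j<k , w≡)
    g : w ∈ˡ vs ⊎ ∃ (λ k → Done (suc i) j k × w ≡ c k) → w ∈ˡ c i ∷ us
    g (inj₁ w∈vs) = there (from (d w) (inj₁ w∈vs))
    g (inj₂ (k , inj₂ j<k , w≡)) = there (from (d w) (inj₂ (k , inj₂ j<k , w≡)))
    g (inj₂ (k , inj₁ k<1+i , w≡)) with ℕ.m≤n⇒m<n∨m≡n (ℕ.s≤s⁻¹ k<1+i)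
    ... | inj₁ k<i  = there (from (d w) (inj₂ (k , inj₁ k<i , w≡)))
    ... | inj₂ refl = here w≡

  drawn-right : ∀ {us i j} → suc j ℕ.≤ last → Drawn us i (suc j) → Drawn (c (suc j) ∷ us) i j
  drawn-right {us} {i} {j} j<last d w = mk⇔ f g
    where
    f : w ∈ˡ c (suc j) ∷ us → _
    f (here w≡)  = inj₂ (suc j , inj₂ (ℕ.≤-refl , j<last) , w≡)
    f (there w∈) with to (d w) w∈
    ... | inj₁ w∈vs                       = inj₁ w∈vs
    ... | inj₂ (k , inj₁ k<i , w≡)        = inj₂ (k , inj₁ k<i , w≡)
    ... | inj₂ (k , inj₂ (j<k , k≤) , w≡) = inj₂ (k , inj₂ (ℕ.<⇒≤ j<k , k≤) , w≡)
    g : w ∈ˡ vs ⊎ ∃ (λ k → Done i j k × w ≡ c k) → w ∈ˡ c (suc j) ∷ us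
    g (inj₁ w∈vs) = there (from (d w) (inj₁ w∈vs))
    g (inj₂ (k , inj₁ k<i , w≡)) = there (from (d w) (inj₂ (k , inj₁ k<i , w≡)))
    g (inj₂ (k , inj₂ (j<k , k≤) , w≡)) with ℕ.m≤n⇒m<n∨m≡n j<k
    ... | inj₁ 1+j<k = there (from (d w) (inj₂ (k , inj₂ (1+j<k , k≤) , w≡)))
    ... | inj₂ refl  = here w≡

  next~ : ∀ {i} → suc i ℕ.≤ last → c i ~ c (suc i)
  next~ i<last = from (cycle ℕ.≤-refl i<last) (inj₁ refl)

  -- The disjunction excludes the closing edge between corners `0` and `last`.
  far≁ : ∀ {i j} → suc i ℕ.< j → j ℕ.≤ last → 0 ℕ.< i ⊎ j ℕ.< last → ¬ (c i ~ c j)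
  far≁ i+1<j j≤ h i~j with to (cycle (ℕ.<⇒≤ i+1<j) j≤) i~j
  ... | inj₁ refl          = ℕ.<-irrefl refl i+1<j
  ... | inj₂ (refl , refl) = Sum.[ (λ ()) , ℕ.<-irrefl refl ] h

  -- A corner strictly between the frontier corners is separated by them from every finished corner
  -- along the cycle; older vertices are excluded by `apart`.
  fresh : ∀ {us i j t} → Drawn us i j → j ℕ.≤ last → i ℕ.< t → t ℕ.< j →
          All (λ w → ¬ (w ~ c t)) us
  fresh {us} {i} {j} {t} d j≤ i<t t<j = All.tabulate λ {w} w∈ → go (to (d w) w∈)
    where
    0<t : 0 ℕ.< t
    0<t = ℕ.≤-<-trans z≤n i<t
    t<last : t ℕ.< last
    t<last = ℕ.<-≤-trans t<j j≤
    go : ∀ {w} → w ∈ˡ vs ⊎ ∃ (λ k → Done i j k × w ≡ c k) → ¬ (w ~ c t)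
    go (inj₁ w∈vs) = apart w∈vs 0<t t<last
    go (inj₂ (k , inj₁ k<i , refl)) =
      far≁ (ℕ.≤-<-trans k<i i<t) (ℕ.<⇒≤ t<last) (inj₂ t<last)
    go (inj₂ (k , inj₂ (j<k , k≤) , refl)) =
      far≁ (ℕ.≤-<-trans t<j j<k) k≤ (inj₁ 0<t) ∘ ~-sym

  -- Only an `Open` drawing is kept, because inside a long face the two frontier corners are in
  -- general not adjacent.
  Progress : ℕ → ℕ → Set
  Progress i j = ∃ λ us → Drawn us i j × Open us (c i) (c j)

  grow-left : ∀ {j} → Progress 0 j → j ℕ.≤ last → ∀ i → suc i ℕ.< j → Progress i j
  grow-left p j≤ zero    _     = p
  grow-left {j} p j≤ (suc i) i+2<j =
    let (us , d , o) = grow-left p j≤ i (ℕ.<⇒≤ i+2<j) in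
    c i ∷ us , drawn-left d ,
    extendA o (fresh d j≤ ℕ.≤-refl (ℕ.<⇒≤ i+2<j))
      (next~ (ℕ.<⇒≤ (ℕ.<-≤-trans (ℕ.<⇒≤ i+2<j) j≤)))
      (far≁ i+2<j j≤ (inj₁ (s≤s z≤n)))

  grow-right : ∀ {i j} e → Progress i (e + j) → e + j ℕ.≤ last → suc i ℕ.< j → Progress i j
  grow-right zero p _ _ = p
  grow-right {i} {j} (suc e) (us , d , o) e+j< i+1<j =
    grow-right e
      (c (suc (e + j)) ∷ us , drawn-right e+j< d ,
       extendB o (fresh d e+j< (ℕ.<⇒≤ i+1<e+j) ℕ.≤-refl) (~-sym (next~ e+j<))
         (far≁ i+1<e+j (ℕ.<⇒≤ e+j<) (inj₂ e+j<) ∘ ~-sym))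
      (ℕ.<⇒≤ e+j<) i+1<j
    where
    i+1<e+j : suc i ℕ.< e + j
    i+1<e+j = ℕ.<-≤-trans i+1<j (ℕ.m≤n+m j e)

  Crossed : ℕ → Set
  Crossed m = ∃ λ us → Drawn us m (suc m) × Rung us (c m) (c (suc m))

  initial : Drawn vs 0 last
  initial w = mk⇔ inj₁ λ { (inj₁ w∈) → w∈
                         ; (inj₂ (_ , inj₂ (l , h) , _)) → ⊥-elim (ℕ.<⇒≱ l h) }

  -- `m` and `m′` count the edges of the two boundary paths between entrance and exit. If both are
  -- positive the two edges are disjoint and the face closes with `bend`. If one is zero they share
  -- a corner, and `hook` closes the face, or `triangle` when it has only three corners.
  cross-face : ∀ m m′ → last ≡ suc (m + m′) → 2 ℕ.≤ last →
               Rung vs (c 0) (c last) → Crossed m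
  cross-face zero zero refl (s≤s ()) r
  cross-face zero (suc zero) refl _ r =
    _ , drawn-right ℕ.≤-refl initial ,
    triangle r (fresh initial ℕ.≤-refl (s≤s z≤n) ℕ.≤-refl)
      (next~ (s≤s z≤n)) (~-sym (next~ ℕ.≤-refl))
  cross-face (suc zero) zero refl _ r =
    _ , drawn-left initial ,
    swap (triangle (swap r) (fresh initial ℕ.≤-refl (s≤s z≤n) ℕ.≤-refl)
            (~-sym (next~ ℕ.≤-refl)) (next~ (s≤s z≤n)))
  -- `hook` adds two corners at once, so the right side is grown only down to corner `3`.
  cross-face zero (suc (suc e)) eq _ r
    with grow-right e (subst (Progress 0) last≡ (vs , initial , Rung.base r))
                    (ℕ.≤-reflexive (≡-sym last≡)) (s≤s (s≤s z≤n))
    where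
    last≡ : last ≡ e + 3
    last≡ = trans eq (ℕ.+-comm 3 e)
  ... | us , d , o =
    _ , drawn-right (ℕ.<⇒≤ 3≤) (drawn-right 3≤ d) ,
    hook o (fresh d 3≤ (s≤s z≤n) ℕ.≤-refl) (fresh d 3≤ (s≤s z≤n) (s≤s (s≤s z≤n)))
      (~-sym (next~ 3≤)) (~-sym (next~ (ℕ.<⇒≤ 3≤))) (next~ (ℕ.<⇒≤ (ℕ.<⇒≤ 3≤)))
      (far≁ ℕ.≤-refl (ℕ.<⇒≤ 3≤) (inj₂ 3≤)) (far≁ ℕ.≤-refl 3≤ (inj₁ (s≤s z≤n)) ∘ ~-sym)
    where
    3≤ : 3 ℕ.≤ last
    3≤ = subst (3 ℕ.≤_) (≡-sym eq) (s≤s (s≤s (s≤s z≤n)))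
  cross-face (suc (suc m)) zero eq _ r
    with grow-left (vs , initial , Rung.base r) ℕ.≤-refl m
                   (subst (suc m ℕ.<_) (≡-sym last≡) (ℕ.m≤n+m (suc (suc m)) 1))
    where
    last≡ : last ≡ suc (suc (suc m))
    last≡ = trans eq (cong (suc ∘ suc ∘ suc) (ℕ.+-identityʳ m))
  ... | us , d , o with trans eq (cong (suc ∘ suc ∘ suc) (ℕ.+-identityʳ m))
  ... | refl =
    _ , drawn-left (drawn-left d) ,
    swap (hook (swap-open o)
      (fresh d ℕ.≤-refl ℕ.≤-refl (ℕ.m≤n+m _ 1)) (fresh d ℕ.≤-refl (ℕ.m≤n+m _ 1) ℕ.≤-refl)
      (next~ (ℕ.m≤n+m _ 2)) (next~ (ℕ.m≤n+m _ 1)) (~-sym (next~ ℕ.≤-refl))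
      (far≁ ℕ.≤-refl ℕ.≤-refl (inj₁ (s≤s z≤n)) ∘ ~-sym)
      (far≁ ℕ.≤-refl (ℕ.m≤n+m _ 1) (inj₂ ℕ.≤-refl)))
  -- `bend` adds both ends of the exit edge, corners `m + 1` and `m + 2`, so growth stops at `m` and
  -- `m + 3`.
  cross-face (suc m) (suc e) eq _ r
    with grow-right e
           (subst (Progress m) last≡
             (grow-left (vs , initial , Rung.base r) ℕ.≤-refl m m+1<))
           (ℕ.≤-reflexive (≡-sym last≡)) (ℕ.m≤n+m (suc (suc m)) 1)
    where
    last≡ : last ≡ e + (3 + m)
    last≡ = trans eq (trans (cong (suc ∘ suc) (ℕ.+-suc m e)) (ℕ.+-comm (3 + m) e))
    m+1< : suc m ℕ.< last
    m+1< = subst (suc m ℕ.<_) (≡-sym eq) (s≤s (s≤s (ℕ.m≤m+n m (suc e))))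
  ... | us , d , o =
    _ , drawn-right m+3≤ (drawn-left d) ,
    swap (bend o (fresh d m+3≤ ℕ.≤-refl (ℕ.m≤n+m _ 1)) (fresh d m+3≤ (ℕ.m≤n+m _ 1) ℕ.≤-refl)
      (next~ (ℕ.<⇒≤ (ℕ.<⇒≤ m+3≤))) (~-sym (next~ m+3≤)) (next~ (ℕ.<⇒≤ m+3≤))
      (far≁ ℕ.≤-refl (ℕ.<⇒≤ m+3≤) (inj₂ m+3≤))
      (far≁ ℕ.≤-refl m+3≤ (inj₁ (s≤s z≤n)) ∘ ~-sym))
    where
    m+3≤ : 3 + m ℕ.≤ last
    m+3≤ = subst (3 + m ℕ.≤_) (≡-sym eq)
             (s≤s (s≤s (subst (suc m ℕ.≤_) (≡-sym (ℕ.+-suc m e)) (s≤s (ℕ.m≤m+n m e)))))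

-- Finite subsets, maximal elements and sorted enumeration

comprehension : ∀ {m} {P : Fin m → Set} → (∀ v → Dec (P v)) → Subset m
comprehension P? = tabulate (does ∘ P?)

∈-comprehension : ∀ {m} {P : Fin m → Set} (P? : ∀ v → Dec (P v)) {v} →
                  (v ∈ comprehension P?) ⇔ P v
∈-comprehension P? {v} = mk⇔
  (λ v∈ → witness (P? v) (trans (≡-sym (Vec.lookup∘tabulate (does ∘ P?) v)) (Vec.[]=⇒lookup v∈)))
  (λ pv → Vec.lookup⇒[]= v _ (trans (Vec.lookup∘tabulate (does ∘ P?) v) (dec-true (P? v) pv)))
  where
  witness : ∀ {A : Set} (d : Dec A) → does d ≡ true → A
  witness (yes a) _ = a

∣pair∣≤2 : ∀ {m} (a b : Fin m) → ∣ ⁅ a ⁆ ∪ ⁅ b ⁆ ∣ ℕ.≤ 2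
∣pair∣≤2 {suc m} Fin.zero Fin.zero = ℕ.≤-trans
  (ℕ.≤-reflexive (trans (cong ∣_∣ (Subset.∪-idem (⁅ Fin.zero {m} ⁆))) (Subset.∣⁅x⁆∣≡1 (Fin.zero {m}))))
  (s≤s z≤n)
∣pair∣≤2 Fin.zero    (Fin.suc b) = s≤s (ℕ.≤-reflexive (trans (cong ∣_∣ (Subset.∪-identityˡ ⁅ b ⁆)) (Subset.∣⁅x⁆∣≡1 b)))
∣pair∣≤2 (Fin.suc a) Fin.zero    = s≤s (ℕ.≤-reflexive (trans (cong ∣_∣ (Subset.∪-identityʳ ⁅ a ⁆)) (Subset.∣⁅x⁆∣≡1 a)))
∣pair∣≤2 (Fin.suc a) (Fin.suc b) = ∣pair∣≤2 a b

third : ∀ {m} {S : Subset m} → 3 ℕ.≤ ∣ S ∣ → ∀ a b → ∃ λ z → z ∈ S × z ≢ a × z ≢ b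
third {S = S} 3≤ a b
  with Fin.any? (λ z → (z Subset.∈? S) ×-dec ¬? (z Fin.≟ a) ×-dec ¬? (z Fin.≟ b))
... | yes found = found
... | no none   = ⊥-elim (ℕ.<⇒≱ 3≤ (ℕ.≤-trans (Subset.p⊆q⇒∣p∣≤∣q∣ inside) (∣pair∣≤2 a b)))
  where
  inside : ∀ {z} → z ∈ S → z ∈ ⁅ a ⁆ ∪ ⁅ b ⁆
  inside {z} z∈S with z Fin.≟ a | z Fin.≟ b
  ... | yes refl | _        = Subset.x∈p∪q⁺ (inj₁ (Subset.x∈⁅x⁆ a))
  ... | no _     | yes refl = Subset.x∈p∪q⁺ (inj₂ (Subset.x∈⁅x⁆ b))
  ... | no z≢a   | no z≢b   = ⊥-elim (none (z , z∈S , z≢a , z≢b))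

another : ∀ {m} → 3 ℕ.≤ m → (a b : Fin m) → ∃ λ z → z ≢ a × z ≢ b
another {m} 3≤m a b =
  let (z , _ , z≢) = third {S = ⊤} (subst (3 ℕ.≤_) (≡-sym (Subset.∣⊤∣≡n m)) 3≤m) a b in z , z≢

three≤∣_∣ : ∀ {m} (S : Subset m) {a b c} → a ∈ S → b ∈ S → c ∈ S →
          a ≢ b → c ≢ a → c ≢ b → 3 ℕ.≤ ∣ S ∣
three≤∣ S ∣ {a} {b} {c} a∈ b∈ c∈ a≢b c≢a c≢b =
  ℕ.≤-trans (s≤s (ℕ.≤-trans (s≤s (ℕ.≤-trans (s≤s z≤n)
    (Subset.x∈p⇒∣p-x∣<∣p∣ {x = c} c∈″))) (Subset.x∈p⇒∣p-x∣<∣p∣ b∈′)))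
    (Subset.x∈p⇒∣p-x∣<∣p∣ a∈)
  where
  b∈′ : b ∈ S - a
  b∈′ = Subset.x∈p∧x≢y⇒x∈p-y b∈ (≢-sym a≢b)
  c∈″ : c ∈ S - a - b
  c∈″ = Subset.x∈p∧x≢y⇒x∈p-y (Subset.x∈p∧x≢y⇒x∈p-y c∈ c≢a) c≢b

module _ {m} {_<_ : Fin m → Fin m → Set}
         (<-trans : ∀ {x y z} → x < y → y < z → x < z) (_<?_ : ∀ x y → Dec (x < y))
         (<-irrefl : ∀ {x} → ¬ (x < x))
         {P : Fin m → Set} (P? : ∀ x → Dec (P x)) where

  private
    _≤_ : Fin m → Fin m → Set
    x ≤ y = y ≡ x ⊎ x < y

    ≤-<-trans : ∀ {x y z} → x ≤ y → y < z → x < z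
    ≤-<-trans (inj₁ refl) y<z = y<z
    ≤-<-trans (inj₂ x<y)  y<z = <-trans x<y y<z

    <⇒≤-trans : ∀ {x y z} → x < y → y ≤ z → x ≤ z
    <⇒≤-trans x<y (inj₁ refl) = inj₂ x<y
    <⇒≤-trans x<y (inj₂ y<z)  = inj₂ (<-trans x<y y<z)

    -- `x` is the current candidate. Returning `x ≤ y` settles the entries that were passed over:
    -- one that is not above `x` cannot be above `y`.
    maximum-in : ∀ (xs : List (Fin m)) {x} → P x →
                 ∃ λ y → P y × x ≤ y × (∀ {z} → z ∈ˡ xs → P z → ¬ (y < z))
    maximum-in [] px = _ , px , inj₁ refl , λ ()
    maximum-in (w ∷ xs) {x} px with P? w | x <? w
    ... | yes pw | yes x<w =
      let (y , py , w≤y , top) = maximum-in xs pw in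
      y , py , <⇒≤-trans x<w w≤y ,
      λ { (here refl) _ y<w → <-irrefl (≤-<-trans w≤y y<w) ; (there z∈) → top z∈ }
    ... | no ¬pw | _ =
      let (y , py , x≤y , top) = maximum-in xs px in
      y , py , x≤y , λ { (here refl) pw → ⊥-elim (¬pw pw) ; (there z∈) → top z∈ }
    ... | yes _ | no x≮w =
      let (y , py , x≤y , top) = maximum-in xs px in
      y , py , x≤y , λ { (here refl) _ y<w → x≮w (≤-<-trans x≤y y<w) ; (there z∈) → top z∈ }

  maximum : ∃ P → ∃ λ y → P y × (∀ z → P z → ¬ (y < z))
  maximum (x , px) = let (y , py , _ , top) = maximum-in (allFin m) px in
                     y , py , λ z → top (∈-allFin z)

module _ {A : Set} where

  -- The default value makes indexing total, which lets the corners of a polygon be a function on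
  -- `ℕ`.
  nth : A → List A → ℕ → A
  nth d []       _       = d
  nth d (x ∷ xs) zero    = x
  nth d (x ∷ xs) (suc k) = nth d xs k

  nth-∈ : ∀ d xs {k} → k ℕ.< length xs → nth d xs k ∈ˡ xs
  nth-∈ d (x ∷ xs) {zero}  _       = here refl
  nth-∈ d (x ∷ xs) {suc k} (s≤s l) = there (nth-∈ d xs l)

  ∈-nth : ∀ d {xs w} → w ∈ˡ xs → ∃ λ k → k ℕ.< length xs × w ≡ nth d xs k
  ∈-nth d (here refl) = 0 , s≤s z≤n , refl
  ∈-nth d (there w∈) = let (k , l , e) = ∈-nth d w∈ in suc k , s≤s l , e

  nth-sorted : ∀ {_<_ : A → A → Set} d {xs} → AllPairs _<_ xs →
               ∀ {i j} → i ℕ.< j → j ℕ.< length xs → nth d xs i < nth d xs j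
  nth-sorted d {x ∷ xs} (p ∷ _)  {zero}  {suc j} _       (s≤s l) = All.lookup p (nth-∈ d xs l)
  nth-sorted d {x ∷ xs} (_ ∷ ps) {suc i} {suc j} (s≤s k) (s≤s l) = nth-sorted d ps k l

module _ {m} {_<_ : Fin m → Fin m → Set} {P : Fin m → Set}
         (<-trans : ∀ {x y z} → x < y → y < z → x < z)
         -- Comparability is asked only on `P`, since `Cyc u` does not compare `u` with other
         -- vertices.
         (compare : ∀ {x y} → P x → P y → x ≢ y → x < y ⊎ y < x)
         (P? : ∀ x → Dec (P x)) where

  private
    insert : ∀ {x} xs → P x → AllPairs _<_ xs → All P xs →
             ∃ λ ys → AllPairs _<_ ys × (∀ {w} → w ∈ˡ ys ⇔ (w ≡ x ⊎ w ∈ˡ xs))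
    insert [] px [] [] = _ ∷ [] , [] ∷ [] , mk⇔ (λ { (here e) → inj₁ e }) λ { (inj₁ e) → here e }
    insert {x} (y ∷ xs) px (s ∷ ss) (py ∷ ps) with x Fin.≟ y
    ... | yes refl = y ∷ xs , s ∷ ss , mk⇔ inj₂ λ { (inj₁ e) → here e ; (inj₂ w∈) → w∈ }
    ... | no x≢y with compare px py x≢y
    ...   | inj₁ x<y = x ∷ y ∷ xs , (x<y ∷ All.map (<-trans x<y) s) ∷ s ∷ ss ,
                       mk⇔ (λ { (here e) → inj₁ e ; (there w∈) → inj₂ w∈ })
                           (λ { (inj₁ e) → here e ; (inj₂ w∈) → there w∈ })
    ...   | inj₂ y<x =
      let (ys , sorted , mem) = insert xs px ss ps in
      y ∷ ys ,
      All.tabulate (λ w∈ → Sum.[ (λ { refl → y<x }) , All.lookup s ] (to mem w∈)) ∷ sorted ,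
      mk⇔ (λ { (here e) → inj₂ (here e) ; (there w∈) → Sum.map₂ there (to mem w∈) })
          (λ { (inj₁ e) → there (from mem (inj₁ e))
             ; (inj₂ (here e)) → here e
             ; (inj₂ (there w∈)) → there (from mem (inj₂ w∈)) })

    sort : ∀ xs → ∃ λ ys → AllPairs _<_ ys × (∀ {w} → w ∈ˡ ys ⇔ (w ∈ˡ xs × P w))
    sort [] = [] , [] , mk⇔ (λ ()) (λ { (() , _) })
    sort (x ∷ xs) with sort xs | P? x
    ... | ys , s , mem | no ¬px = ys , s ,
      mk⇔ (λ w∈ → let (w∈xs , pw) = to mem w∈ in there w∈xs , pw)
          (λ { (here refl , pw) → ⊥-elim (¬px pw) ; (there w∈ , pw) → from mem (w∈ , pw) })
    ... | ys , s , mem | yes px =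
      let (zs , s′ , mem′) = insert ys px s (All.tabulate (λ w∈ → proj₂ (to mem w∈))) in
      zs , s′ ,
      mk⇔ (λ w∈ → Sum.[ (λ { refl → here refl , px })
                      , (λ w∈ys → let (q , pw) = to mem w∈ys in there q , pw) ] (to mem′ w∈))
          (λ { (here refl , _) → from mem′ (inj₁ refl)
             ; (there w∈ , pw) → from mem′ (inj₂ (from mem (w∈ , pw))) })

  enumerate : ∃ λ ys → AllPairs _<_ ys × (∀ {w} → w ∈ˡ ys ⇔ P w)
  enumerate = let (ys , s , mem) = sort (allFin m) in
              ys , s , mk⇔ (λ w∈ → proj₂ (to mem w∈)) (λ pw → from mem (∈-allFin _ , pw))

-- Cyclic order on the circle and the corners of a face

module Circle (G : Graph) (pos : Fin (n G) → Fin (n G)) (pos-injective : Injective _≡_ _≡_ pos) where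

  V : Set
  V = Fin (n G)

  _~_ : V → V → Set
  _~_ = Adj G

  ~-sym : ∀ {u v} → u ~ v → v ~ u
  ~-sym {u} {v} uv = trans (Graph.sym G v u) uv

  _≺_ : V → V → Set
  u ≺ v = toℕ (pos u) ℕ.< toℕ (pos v)

  -- a, b, c occur in this clockwise order on the circle
  Cyc : V → V → V → Set
  Cyc a b c = (a ≺ b × b ≺ c) ⊎ (b ≺ c × c ≺ a) ⊎ (c ≺ a × a ≺ b)

  cyc? : ∀ a b c → Dec (Cyc a b c)
  cyc? a b c = (a ≺? b ×-dec b ≺? c) ⊎-dec (b ≺? c ×-dec c ≺? a) ⊎-dec (c ≺? a ×-dec a ≺? b)
    where _≺?_ : ∀ u v → Dec (u ≺ v)
          u ≺? v = toℕ (pos u) ℕ.<? toℕ (pos v)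

  private
    _⊳_ : ∀ {a b c} → a ≺ b → b ≺ c → a ≺ c
    _⊳_ = ℕ.<-trans
    ≺-asym : ∀ {a b} {A : Set} → a ≺ b → b ≺ a → A
    ≺-asym p q = ⊥-elim (ℕ.<-asym p q)

  cyc-rot : ∀ {a b c} → Cyc a b c → Cyc b c a
  cyc-rot (inj₁ p)        = inj₂ (inj₂ p)
  cyc-rot (inj₂ (inj₁ p)) = inj₁ p
  cyc-rot (inj₂ (inj₂ p)) = inj₂ (inj₁ p)

  cyc-rot² : ∀ {a b c} → Cyc a b c → Cyc c a b
  cyc-rot² = cyc-rot ∘ cyc-rot

  cyc-asym : ∀ {a b c} → Cyc a b c → ¬ Cyc c b a
  cyc-asym (inj₁ (p , q))        (inj₁ (r , s))        = ≺-asym p s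
  cyc-asym (inj₁ (p , q))        (inj₂ (inj₁ (r , s))) = ≺-asym p r
  cyc-asym (inj₁ (p , q))        (inj₂ (inj₂ (r , s))) = ≺-asym q s
  cyc-asym (inj₂ (inj₁ (p , q))) (inj₁ (r , s))        = ≺-asym p r
  cyc-asym (inj₂ (inj₁ (p , q))) (inj₂ (inj₁ (r , s))) = ≺-asym q s
  cyc-asym (inj₂ (inj₁ (p , q))) (inj₂ (inj₂ (r , s))) = ≺-asym p s
  cyc-asym (inj₂ (inj₂ (p , q))) (inj₁ (r , s))        = ≺-asym q s
  cyc-asym (inj₂ (inj₂ (p , q))) (inj₂ (inj₁ (r , s))) = ≺-asym q r
  cyc-asym (inj₂ (inj₂ (p , q))) (inj₂ (inj₂ (r , s))) = ≺-asym p r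

  -- For fixed `a` this makes `Cyc a` the strict order in which the circle is read clockwise from
  -- `a`, so `maximum` and `enumerate` apply to it.
  cyc-trans : ∀ {a b c d} → Cyc a b c → Cyc a c d → Cyc a b d
  cyc-trans (inj₁ (p , q))        (inj₁ (r , s))        = inj₁ (p , q ⊳ s)
  cyc-trans (inj₁ (p , q))        (inj₂ (inj₁ (r , s))) = inj₂ (inj₂ (s , p))
  cyc-trans (inj₁ (p , q))        (inj₂ (inj₂ (r , s))) = inj₂ (inj₂ (r , p))
  cyc-trans (inj₂ (inj₁ (p , q))) (inj₁ (r , s))        = ≺-asym q r
  cyc-trans (inj₂ (inj₁ (p , q))) (inj₂ (inj₁ (r , s))) = inj₂ (inj₁ (p ⊳ r , s))
  cyc-trans (inj₂ (inj₁ (p , q))) (inj₂ (inj₂ (r , s))) = ≺-asym q s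
  cyc-trans (inj₂ (inj₂ (p , q))) (inj₁ (r , s))        = ≺-asym p r
  cyc-trans (inj₂ (inj₂ (p , q))) (inj₂ (inj₁ (r , s))) = inj₂ (inj₂ (s , q))
  cyc-trans (inj₂ (inj₂ (p , q))) (inj₂ (inj₂ (r , s))) = ≺-asym p s

  ≺-total : ∀ {a b} → a ≢ b → a ≺ b ⊎ b ≺ a
  ≺-total {a} {b} a≢b with ℕ.<-cmp (toℕ (pos a)) (toℕ (pos b))
  ... | tri< p _ _ = inj₁ p
  ... | tri≈ _ e _ = ⊥-elim (a≢b (pos-injective (Fin.toℕ-injective e)))
  ... | tri> _ _ q = inj₂ q

  cyc-total : ∀ {a b c} → a ≢ b → b ≢ c → a ≢ c → Cyc a b c ⊎ Cyc c b a
  cyc-total a≢b b≢c a≢c with ≺-total a≢b | ≺-total b≢c | ≺-total a≢c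
  ... | inj₁ p | inj₁ q | _      = inj₁ (inj₁ (p , q))
  ... | inj₁ p | inj₂ q | inj₁ r = inj₂ (inj₂ (inj₂ (r , q)))
  ... | inj₁ p | inj₂ q | inj₂ r = inj₁ (inj₂ (inj₂ (r , p)))
  ... | inj₂ p | inj₁ q | inj₁ r = inj₂ (inj₂ (inj₁ (p , r)))
  ... | inj₂ p | inj₁ q | inj₂ r = inj₁ (inj₂ (inj₁ (q , r)))
  ... | inj₂ p | inj₂ q | _      = inj₂ (inj₁ (q , p))

  cyc-irrefl : ∀ {a b} → ¬ Cyc a b a
  cyc-irrefl p = cyc-asym p p

  cyc-≢₁₂ : ∀ {a b c} → Cyc a b c → a ≢ b
  cyc-≢₁₂ p refl = cyc-irrefl (cyc-rot p)

  cyc-≢₂₃ : ∀ {a b c} → Cyc a b c → b ≢ c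
  cyc-≢₂₃ p = cyc-≢₁₂ (cyc-rot p)

  cyc-≢₁₃ : ∀ {a b c} → Cyc a b c → a ≢ c
  cyc-≢₁₃ p refl = cyc-irrefl p

  cyc-asymˡ : ∀ {a b c} → Cyc a b c → ¬ Cyc b a c
  cyc-asymˡ p q = cyc-asym (cyc-rot² p) q

  cyc-asymʳ : ∀ {a b c} → Cyc a b c → ¬ Cyc a c b
  cyc-asymʳ p q = cyc-asym p (cyc-rot q)

  cyc-drop : ∀ {a x y z} → Cyc a x y → Cyc a y z → Cyc x y z
  cyc-drop p q = cyc-rot² (cyc-trans (cyc-rot q) (cyc-rot² p))

  cyc-flip : ∀ {a x y} → a ≢ x → a ≢ y → x ≢ y → ¬ Cyc a x y → Cyc a y x
  cyc-flip a≢x a≢y x≢y ¬p with cyc-total a≢x x≢y a≢y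
  ... | inj₁ p = ⊥-elim (¬p p)
  ... | inj₂ q = cyc-rot² q

  -- With `consec⇐` this replaces the two linear cases of `Consec`, one of which wraps around, by a
  -- single statement about an empty arc.
  consec⇒ : ∀ {S u v} → Consec G pos S u v → ∀ {w} → w ∈ S → ¬ Cyc u w v
  consec⇒ (inj₁ (u≺v , h)) w∈ (inj₁ p)              = h _ w∈ p
  consec⇒ (inj₁ (u≺v , h)) w∈ (inj₂ (inj₁ (_ , q))) = ≺-asym u≺v q
  consec⇒ (inj₁ (u≺v , h)) w∈ (inj₂ (inj₂ (q , _))) = ≺-asym u≺v q
  consec⇒ (inj₂ (v≺u , h)) w∈ (inj₁ (p , q))        = proj₁ (h _ w∈) p
  consec⇒ (inj₂ (v≺u , h)) w∈ (inj₂ (inj₁ (q , _))) = proj₂ (h _ w∈) q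
  consec⇒ (inj₂ (v≺u , h)) w∈ (inj₂ (inj₂ (_ , p))) = proj₁ (h _ w∈) p

  consec-≢ : ∀ {S u v} → Consec G pos S u v → u ≢ v
  consec-≢ (inj₁ (p , _)) refl = ℕ.<-irrefl refl p
  consec-≢ (inj₂ (p , _)) refl = ℕ.<-irrefl refl p

  consec⇐ : ∀ {S u v} → u ≢ v → (∀ {w} → w ∈ S → ¬ Cyc u w v) → Consec G pos S u v
  consec⇐ u≢v h with ≺-total u≢v
  ... | inj₁ u≺v = inj₁ (u≺v , λ w w∈ p → h w∈ (inj₁ p))
  ... | inj₂ v≺u = inj₂ (v≺u , λ w w∈ → (λ u≺w → h w∈ (inj₂ (inj₂ (v≺u , u≺w))))
                                     , λ w≺v → h w∈ (inj₂ (inj₁ (w≺v , v≺u))))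

  side⇒adj : ∀ {S} → Face G pos S → ∀ {u v} → u ∈ S → v ∈ S → u ≢ v →
             (∀ {w} → w ∈ S → ¬ Cyc u w v) → u ~ v
  side⇒adj (_ , f) u∈ v∈ u≢v h = from (f _ _ u∈ v∈ u≢v) (inj₁ (consec⇐ u≢v h))

  -- Read clockwise from `v`, `t′` is the first vertex of `T` and `t` the last. The arc through `v`
  -- between them is free of `T`, so they form a side: the side behind which `v` lies.
  gap : ∀ {T v} → Face G pos T → v ∉ T →
        ∃ λ t → ∃ λ t′ → t ∈ T × t′ ∈ T × t ~ t′ × Cyc t v t′ ×
          (∀ {w} → w ∈ T → w ≢ t → w ≢ t′ → Cyc t′ w t)
  gap {T} {v} face v∉ with third (proj₁ face) v v
  ... | x , x∈ , _ , _
    with maximum {_<_ = Cyc v} cyc-trans (cyc? v) (cyc-irrefl ∘ cyc-rot²) (Subset._∈? T) (x , x∈)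
       | maximum {_<_ = flip (Cyc v)} (flip cyc-trans) (flip (cyc? v)) (cyc-irrefl ∘ cyc-rot²)
                 (Subset._∈? T) (x , x∈)
  ... | t , t∈ , top | t′ , t′∈ , bot =
    t , t′ , t∈ , t′∈ ,
    side⇒adj face t∈ t′∈ t≢t′
      (λ w∈ p → cyc-asym p (between w∈ (≢-sym (cyc-≢₁₂ p)) (cyc-≢₂₃ p))) ,
    cyc-rot² (cyc-flip v≢t v≢t′ t≢t′ (top t′ t′∈)) ,
    between
    where
    off : ∀ {w} → w ∈ T → v ≢ w
    off w∈ refl = v∉ w∈
    v≢t  = off t∈
    v≢t′ = off t′∈
    between : ∀ {w} → w ∈ T → w ≢ t → w ≢ t′ → Cyc t′ w t
    between w∈ w≢t w≢t′ =
      cyc-drop (cyc-flip (off w∈) v≢t′ w≢t′ (bot _ w∈))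
               (cyc-flip v≢t (off w∈) (≢-sym w≢t) (top _ w∈))
    t≢t′ : t ≢ t′
    t≢t′ refl with third (proj₁ face) t t
    ... | z , z∈ , z≢t , _ = cyc-irrefl (between z∈ z≢t z≢t)

  record Polygon (S : Subset (n G)) : Set where
    field
      corner   : ℕ → V
      last     : ℕ
      2≤last   : 2 ℕ.≤ last
      distinct : ∀ {i j} → i ℕ.< j → j ℕ.≤ last → corner i ≢ corner j
      cycle    : ∀ {i j} → i ℕ.< j → j ℕ.≤ last →
                 (corner i ~ corner j) ⇔ (suc i ≡ j ⊎ (i ≡ 0 × j ≡ last))
      members  : ∀ {w} → w ∈ S ⇔ ∃ λ k → k ℕ.≤ last × w ≡ corner k

  -- Sorting the remaining vertices by `Cyc u` lists the corners clockwise. The predecessor of `u`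
  -- comes last, so an entrance edge can be made to join the first and last corner.
  enumerate-face : ∀ {S u} → Face G pos S → u ∈ S → Σ (Polygon S) λ P → let open Polygon P in
                   corner 0 ≡ u × (∀ {l} → l ∈ S → Consec G pos S l u → corner last ≡ l)
  enumerate-face {S} {u} face u∈
    with enumerate {_<_ = Cyc u} {P = λ w → w ∈ S × u ≢ w} cyc-trans
           (λ (_ , u≢x) (_ , u≢y) x≢y → Sum.map₂ cyc-rot² (cyc-total u≢x x≢y u≢y))
           (λ w → (w Subset.∈? S) ×-dec ¬? (u Fin.≟ w))
  ... | xs , sorted , mem =
    record { corner = c ; last = last ; 2≤last = 2≤last ; distinct = distinct
           ; cycle = cycle ; members = members } , refl , c-last
    where
    c : ℕ → V
    c = nth u (u ∷ xs)
    last : ℕ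
    last = length xs
    c∈S : ∀ {k} → k ℕ.≤ last → c k ∈ S
    c∈S {zero}  _ = u∈
    c∈S {suc k} p = proj₁ (to mem (nth-∈ u xs p))
    members : ∀ {w} → w ∈ S ⇔ ∃ λ k → k ℕ.≤ last × w ≡ c k
    members {w} = mk⇔ f λ { (k , k≤ , refl) → c∈S k≤ }
      where
      f : w ∈ S → ∃ λ k → k ℕ.≤ last × w ≡ c k
      f w∈ with u Fin.≟ w
      ... | yes refl = 0 , z≤n , refl
      ... | no u≢w   = let (k , k< , e) = ∈-nth u (from mem (w∈ , u≢w)) in suc k , k< , e
    distinct : ∀ {i j} → i ℕ.< j → j ℕ.≤ last → c i ≢ c j
    distinct {zero}  {suc j} _       j≤ = proj₂ (to mem (nth-∈ u xs j≤))
    distinct {suc i} {suc j} (s≤s p) j≤ = cyc-≢₂₃ (nth-sorted u sorted p j≤)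
    cyclic : ∀ {i j k} → i ℕ.< j → j ℕ.< k → k ℕ.≤ last → Cyc (c i) (c j) (c k)
    cyclic {zero}  {suc j} {suc k} _       (s≤s q) k≤ = nth-sorted u sorted q k≤
    cyclic {suc i} {suc j} {suc k} (s≤s p) (s≤s q) k≤ =
      cyc-drop (nth-sorted u sorted p (ℕ.<-trans q k≤)) (nth-sorted u sorted q k≤)
    2≤last : 2 ℕ.≤ last
    2≤last with third (proj₁ face) u u
    ... | x , x∈ , x≢u , _ with third (proj₁ face) u x
    ... | y , y∈ , y≢u , y≢x = two xs (from mem (x∈ , ≢-sym x≢u)) (from mem (y∈ , ≢-sym y≢u))
      where
      two : ∀ zs → x ∈ˡ zs → y ∈ˡ zs → 2 ℕ.≤ length zs
      two (_ ∷ [])    (here p) (here q) = ⊥-elim (y≢x (trans q (≡-sym p)))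
      two (_ ∷ _ ∷ _) _ _               = s≤s (s≤s z≤n)
    c-last : ∀ {l} → l ∈ S → Consec G pos S l u → c last ≡ l
    c-last l∈ con with to members l∈
    ... | zero , _ , l≡ = ⊥-elim (consec-≢ con l≡)
    ... | suc k , k< , l≡ with ℕ.m≤n⇒m<n∨m≡n k<
    ... | inj₂ e = trans (cong c (≡-sym e)) (≡-sym l≡)
    ... | inj₁ k<last = ⊥-elim (consec⇒ con (c∈S ℕ.≤-refl)
            (subst (λ z → Cyc z (c last) u) (≡-sym l≡)
              (cyc-rot (cyclic {0} (s≤s z≤n) k<last ℕ.≤-refl))))
    wrap : ∀ {i j} → i ℕ.< j → j ℕ.≤ last → Consec G pos S (c j) (c i) → i ≡ 0 × j ≡ last
    wrap {suc i} i<j j≤ p = ⊥-elim (consec⇒ p u∈ (cyc-rot² (cyclic {0} (s≤s z≤n) i<j j≤)))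
    wrap {zero} i<j j≤ p with ℕ.m≤n⇒m<n∨m≡n j≤
    ... | inj₂ e  = refl , e
    ... | inj₁ j< = ⊥-elim (consec⇒ p (c∈S ℕ.≤-refl) (cyc-rot (cyclic i<j j< ℕ.≤-refl)))
    cycle : ∀ {i j} → i ℕ.< j → j ℕ.≤ last → (c i ~ c j) ⇔ (suc i ≡ j ⊎ (i ≡ 0 × j ≡ last))
    cycle {i} {j} i<j j≤ = mk⇔ (sides ∘ to adj⇔side) (from adj⇔side ∘ consecutive)
      where
      i≤ : i ℕ.≤ last
      i≤ = ℕ.≤-trans (ℕ.<⇒≤ i<j) j≤
      ci≢cj = distinct i<j j≤
      adj⇔side = proj₂ face (c i) (c j) (c∈S i≤) (c∈S j≤) ci≢cj
      sides : Side G pos S (c i) (c j) → suc i ≡ j ⊎ (i ≡ 0 × j ≡ last)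
      sides (inj₁ p) with ℕ.m≤n⇒m<n∨m≡n i<j
      ... | inj₁ i+1<j = ⊥-elim (consec⇒ p (c∈S (ℕ.≤-trans i<j j≤)) (cyclic ℕ.≤-refl i+1<j j≤))
      ... | inj₂ e     = inj₁ e
      sides (inj₂ p) = inj₂ (wrap i<j j≤ p)
      consecutive : suc i ≡ j ⊎ (i ≡ 0 × j ≡ last) → Side G pos S (c i) (c j)
      consecutive (inj₁ refl) = inj₁ (consec⇐ ci≢cj λ w∈ → avoid (to members w∈))
        where
        avoid : ∀ {w} → ∃ (λ k → k ℕ.≤ last × w ≡ c k) → ¬ Cyc (c i) w (c (suc i))
        avoid (k , k≤ , refl) q with ℕ.<-cmp k i
        ... | tri< k<i _ _  = cyc-asymˡ q (cyclic k<i i<j j≤)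
        ... | tri≈ _ refl _ = cyc-≢₁₂ q refl
        ... | tri> _ _ i<k with ℕ.m≤n⇒m<n∨m≡n i<k
        ...   | inj₁ i+1<k = cyc-asymʳ q (cyclic i<j i+1<k k≤)
        ...   | inj₂ refl  = cyc-≢₂₃ q refl
      consecutive (inj₂ (refl , refl)) = inj₂ (consec⇐ (≢-sym ci≢cj) λ w∈ → avoid (to members w∈))
        where
        avoid : ∀ {w} → ∃ (λ k → k ℕ.≤ last × w ≡ c k) → ¬ Cyc (c last) w u
        avoid (zero , _ , refl) q = cyc-≢₂₃ q refl
        avoid (suc k , k≤ , refl) q with ℕ.m≤n⇒m<n∨m≡n k≤
        ... | inj₁ k<last = cyc-asym q (cyclic {0} (s≤s z≤n) k<last ℕ.≤-refl)
        ... | inj₂ e      = cyc-≢₁₂ q (cong c (≡-sym e))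

  -- Edges as barriers, and faces beside a given edge

  module Plane (noCrossing : NoCrossing G pos) where

    -- Renaming or reversing the two edges brings each consistent cyclic position to the linear
    -- pattern that `NoCrossing` forbids.
    no-crossing : ∀ {a b c d} → a ~ b → c ~ d → Cyc a c b → ¬ Cyc b d a
    no-crossing ab cd (inj₁ (p , q)) (inj₁ (r , s))               = ≺-asym (p ⊳ q) (r ⊳ s)
    no-crossing ab cd (inj₁ (p , q)) (inj₂ (inj₁ (r , s)))        = noCrossing _ _ _ _ (~-sym cd) ab (r , p , q)
    no-crossing ab cd (inj₁ (p , q)) (inj₂ (inj₂ (r , s)))        = noCrossing _ _ _ _ ab cd (p , q , s)
    no-crossing ab cd (inj₂ (inj₁ (p , q))) (inj₁ (r , s))        = noCrossing _ _ _ _ cd (~-sym ab) (p , r , s)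
    no-crossing ab cd (inj₂ (inj₁ (p , q))) (inj₂ (inj₁ (r , s))) = ≺-asym q s
    no-crossing ab cd (inj₂ (inj₁ (p , q))) (inj₂ (inj₂ (r , s))) = ≺-asym q r
    no-crossing ab cd (inj₂ (inj₂ (p , q))) (inj₁ (r , s))        = noCrossing _ _ _ _ (~-sym ab) (~-sym cd) (r , s , q)
    no-crossing ab cd (inj₂ (inj₂ (p , q))) (inj₂ (inj₁ (r , s))) = ≺-asym p s
    no-crossing ab cd (inj₂ (inj₂ (p , q))) (inj₂ (inj₂ (r , s))) = ≺-asym p r

    private
      -- `b` lies behind a side `t t′` of the face. The edge `a b` cannot cross this side, so `a` is
      -- on the same closed arc. That arc has no vertex of `S` in its interior, which leaves one
      -- side of `a b` empty.
      one-sided-∉ : ∀ {S a b x y} → Face G pos S → a ~ b → b ∉ S → x ∈ S → y ∈ S →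
                    Cyc a x b → ¬ Cyc b y a
      one-sided-∉ {S} {a} {b} {x} {y} face ab b∉ x∈ y∈ axb bya with gap face b∉
      ... | t , t′ , t∈ , t′∈ , tt′ , tbt′ , rest = impossible
        where
        empty : ∀ {w} → w ∈ S → ¬ Cyc t w t′
        empty w∈ p = cyc-asym p (rest w∈ (≢-sym (cyc-≢₁₂ p)) (cyc-≢₂₃ p))
        impossible : ⊥
        impossible with t Fin.≟ a | t′ Fin.≟ a | cyc? t a t′
        ... | yes refl | _ | _ = empty x∈ (cyc-trans axb tbt′)
        ... | no _ | yes refl | _ =
          empty y∈ (cyc-rot (cyc-trans (cyc-rot² tbt′) (cyc-rot² bya)))
        ... | no t≢a | no t′≢a | no ¬tat′ =
          no-crossing tt′ (~-sym ab) tbt′ (cyc-rot (cyc-flip t≢a (cyc-≢₁₃ tbt′) (≢-sym t′≢a) ¬tat′))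
        ... | no t≢a | no t′≢a | yes tat′ with cyc? t a b
        ...   | yes tab = empty x∈ (cyc-trans (cyc-rot (cyc-trans (cyc-rot² tab) (cyc-rot² axb))) tbt′)
        ...   | no ¬tab = empty y∈ (cyc-trans (cyc-rot (cyc-trans (cyc-rot² tba) (cyc-rot² bya))) tat′)
          where
          tba : Cyc t b a
          tba = cyc-flip t≢a (cyc-≢₁₂ tbt′) (≢-sym (cyc-≢₁₃ bya)) ¬tab

    -- If both ends belong to `S`, the edge must be a side, because a face has no diagonal;
    -- otherwise a missing end reduces to `one-sided-∉`.
    one-sided : ∀ {S a b x y} → Face G pos S → a ~ b → x ∈ S → y ∈ S →
                Cyc a x b → ¬ Cyc b y a
    one-sided {S} {a} {b} face ab x∈ y∈ axb bya with a Subset.∈? S | b Subset.∈? S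
    ... | _      | no b∉  = one-sided-∉ face ab b∉ x∈ y∈ axb bya
    ... | no a∉  | _      = one-sided-∉ face (~-sym ab) a∉ y∈ x∈ bya axb
    ... | yes a∈ | yes b∈ with to (proj₂ face a b a∈ b∈ (cyc-≢₁₃ axb)) ab
    ...   | inj₁ con = consec⇒ con x∈ axb
    ...   | inj₂ con = consec⇒ con y∈ bya

    private
      -- If `v` were not in `T`, it would lie behind a side `t t′` of `T`, and `one-sided` leaves
      -- `S` and `T` no common vertices but `t` and `t′`. So `a b` is that side; but `v` and the
      -- rest of `T` lie on opposite sides of it, and one of these is forbidden.
      same-side-⊆ : ∀ {S T a b} → Face G pos S → Face G pos T →
                    a ∈ S → b ∈ S → a ∈ T → b ∈ T → a ≢ b →
                    (∀ {w} → w ∈ S → ¬ Cyc b w a) → (∀ {w} → w ∈ T → ¬ Cyc b w a) →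
                    ∀ {v} → v ∈ S → v ∈ T
      same-side-⊆ {S} {T} {a} {b} fS fT aS bS aT bT a≢b sS sT {v} v∈S with v Subset.∈? T
      ... | yes v∈T = v∈T
      ... | no v∉T with gap fT v∉T
      ...   | t , t′ , t∈ , t′∈ , tt′ , tvt′ , rest =
        ⊥-elim (ends (end aS aT) (end bS bT))
        where
        end : ∀ {w} → w ∈ S → w ∈ T → w ≡ t ⊎ w ≡ t′
        end {w} wS wT with w Fin.≟ t | w Fin.≟ t′
        ... | yes e  | _      = inj₁ e
        ... | no _   | yes e  = inj₂ e
        ... | no w≢t | no w≢t′ = ⊥-elim (one-sided fS tt′ v∈S wS tvt′ (rest wT w≢t w≢t′))
        ends : a ≡ t ⊎ a ≡ t′ → b ≡ t ⊎ b ≡ t′ → ⊥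
        ends (inj₁ refl) (inj₁ refl) = a≢b refl
        ends (inj₂ refl) (inj₂ refl) = a≢b refl
        ends (inj₂ refl) (inj₁ refl) = sS v∈S tvt′
        ends (inj₁ refl) (inj₂ refl) with third (proj₁ fT) t t′
        ... | z , z∈ , z≢t , z≢t′ = sT z∈ (rest z∈ z≢t z≢t′)

    face-unique : ∀ {S T a b} → Face G pos S → Face G pos T →
                  a ∈ S → b ∈ S → a ∈ T → b ∈ T → a ≢ b →
                  (∀ {w} → w ∈ S → ¬ Cyc b w a) → (∀ {w} → w ∈ T → ¬ Cyc b w a) → S ≡ T
    face-unique fS fT aS bS aT bT a≢b sS sT = Subset.⊆-antisym
      (same-side-⊆ fS fT aS bS aT bT a≢b sS sT) (same-side-⊆ fT fS aT bT aS bS a≢b sT sS)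

    -- The bounded face to the side of the edge a b on which c lies consists of the
    -- vertices of the arc from a to b that no other edge within the arc cuts off.
    module Inner (bic : Biconnected G) {a b c : V} (ab : a ~ b) (acb : Cyc a c b) where

      -- The linear order obtained by cutting the circle just before `a`; the first summand makes
      -- `a` the least element.
      _⊏_ : V → V → Set
      x ⊏ y = (x ≡ a × y ≢ a) ⊎ Cyc a x y

      _⊑_ : V → V → Set
      x ⊑ y = x ⊏ y ⊎ x ≡ y

      _⊏?_ : ∀ x y → Dec (x ⊏ y)
      x ⊏? y = (x Fin.≟ a ×-dec ¬? (y Fin.≟ a)) ⊎-dec cyc? a x y

      _⊑?_ : ∀ x y → Dec (x ⊑ y)
      x ⊑? y = x ⊏? y ⊎-dec x Fin.≟ y

      ⊏⇒≢a : ∀ {x y} → x ⊏ y → y ≢ a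
      ⊏⇒≢a (inj₁ (_ , y≢a)) = y≢a
      ⊏⇒≢a (inj₂ p)         = ≢-sym (cyc-≢₁₃ p)

      ⊏-trans : ∀ {x y z} → x ⊏ y → y ⊏ z → x ⊏ z
      ⊏-trans (inj₁ (x≡a , _)) q                   = inj₁ (x≡a , ⊏⇒≢a q)
      ⊏-trans (inj₂ p)         (inj₁ (refl , _))   = ⊥-elim (cyc-≢₁₃ p refl)
      ⊏-trans (inj₂ p)         (inj₂ q)            = inj₂ (cyc-trans p q)

      ⊏-irrefl : ∀ {x} → ¬ (x ⊏ x)
      ⊏-irrefl (inj₁ (x≡a , x≢a)) = x≢a x≡a
      ⊏-irrefl (inj₂ p)           = cyc-≢₂₃ p refl

      ⊏-total : ∀ {x y} → x ≢ y → x ⊏ y ⊎ y ⊏ x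
      ⊏-total {x} {y} x≢y with x Fin.≟ a | y Fin.≟ a
      ... | yes refl | _        = inj₁ (inj₁ (refl , ≢-sym x≢y))
      ... | no x≢a   | yes refl = inj₂ (inj₁ (refl , x≢a))
      ... | no x≢a   | no y≢a   =
        Sum.map inj₂ (inj₂ ∘ cyc-rot²) (cyc-total (≢-sym x≢a) x≢y (≢-sym y≢a))

      ⊏-⊑-trans : ∀ {x y z} → x ⊏ y → y ⊑ z → x ⊏ z
      ⊏-⊑-trans p (inj₁ q)    = ⊏-trans p q
      ⊏-⊑-trans p (inj₂ refl) = p

      ⊑-⊏-trans : ∀ {x y z} → x ⊑ y → y ⊏ z → x ⊏ z
      ⊑-⊏-trans (inj₁ p)    q = ⊏-trans p q
      ⊑-⊏-trans (inj₂ refl) q = q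

      ⊏-or-⊒ : ∀ x y → x ⊏ y ⊎ y ⊑ x
      ⊏-or-⊒ x y with x Fin.≟ y
      ... | yes e  = inj₂ (inj₂ (≡-sym e))
      ... | no x≢y = Sum.map₂ inj₁ (⊏-total x≢y)

      a⊏ : ∀ {x} → x ≢ a → a ⊏ x
      a⊏ x≢a = inj₁ (refl , x≢a)

      a⊑ : ∀ x → a ⊑ x
      a⊑ x with x Fin.≟ a
      ... | yes refl = inj₂ refl
      ... | no x≢a   = inj₁ (a⊏ x≢a)

      ⊏⇒≢ : ∀ {x y} → x ⊏ y → x ≢ y
      ⊏⇒≢ p refl = ⊏-irrefl p

      ⊏⇒cyc : ∀ {x y z} → x ⊏ y → y ⊏ z → Cyc x y z
      ⊏⇒cyc (inj₁ (refl , y≢a)) (inj₁ (y≡a , _)) = ⊥-elim (y≢a y≡a)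
      ⊏⇒cyc (inj₁ (refl , _))   (inj₂ q)          = q
      ⊏⇒cyc (inj₂ p)            (inj₁ (refl , _)) = ⊥-elim (cyc-≢₁₃ p refl)
      ⊏⇒cyc (inj₂ p)            (inj₂ q)          = cyc-drop p q

      cyc⇒⊏ : ∀ {x y z} → x ⊏ z → Cyc x y z → x ⊏ y × y ⊏ z
      cyc⇒⊏ xz p with ⊏-total (cyc-≢₁₂ p) | ⊏-total (cyc-≢₂₃ p)
      ... | inj₂ yx | _       = ⊥-elim (cyc-asymˡ p (⊏⇒cyc yx xz))
      ... | inj₁ xy | inj₂ zy = ⊥-elim (cyc-asymʳ p (⊏⇒cyc xz zy))
      ... | inj₁ xy | inj₁ yz = xy , yz

      ⊏-no-crossing : ∀ {x y z w} → x ~ z → y ~ w → x ⊏ y → y ⊏ z → ¬ (z ⊏ w)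
      ⊏-no-crossing xz yw p q r =
        no-crossing xz yw (⊏⇒cyc p q) (cyc-rot (⊏⇒cyc (⊏-trans p q) r))

      a⊏c : a ⊏ c
      a⊏c = a⊏ (≢-sym (cyc-≢₁₂ acb))
      c⊏b : c ⊏ b
      c⊏b = inj₂ acb
      a⊏b : a ⊏ b
      a⊏b = ⊏-trans a⊏c c⊏b

      Chord : V → V → Set
      Chord x y = x ~ y × x ⊏ y × y ⊑ b × ¬ (x ≡ a × y ≡ b)

      chord? : ∀ x y → Dec (Chord x y)
      chord? x y = (adj G x y Bool.≟ true) ×-dec x ⊏? y ×-dec y ⊑? b ×-dec
                   ¬? (x Fin.≟ a ×-dec y Fin.≟ b)

      Covered : V → Set
      Covered v = ∃ λ x → ∃ λ y → Chord x y × x ⊏ v × v ⊏ y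

      Visible : V → Set
      Visible v = v ⊑ b × ¬ Covered v

      visible? : ∀ v → Dec (Visible v)
      visible? v = v ⊑? b ×-dec
        ¬? (Fin.any? λ x → Fin.any? λ y → chord? x y ×-dec x ⊏? v ×-dec v ⊏? y)

      visible-a : Visible a
      visible-a = inj₁ a⊏b , λ (_ , _ , _ , x⊏a , _) → ⊏⇒≢a x⊏a refl

      visible-b : Visible b
      visible-b = inj₂ refl , λ (_ , _ , (_ , _ , y⊑b , _) , _ , b⊏y) → ⊏-irrefl (⊏-⊑-trans b⊏y y⊑b)

      closed : ∀ {ok : V → Set} (X : V → Set) → (∀ {z z′} → X z → z ~ z′ → ok z′ → X z′) →
               ∀ {z w} → X z → Reach G ok z w → X w
      closed X h xz (Defs.here _)               = xz
      closed X h xz (step _ zv r@(Defs.here ok))     = closed X h (h xz zv ok) r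
      closed X h xz (step _ zv r@(step ok _ _)) = closed X h (h xz zv ok) r

      -- A missing chord would make b (if u is a) or a a cut vertex.
      chord-from : ∀ {u} → Visible u → u ⊏ b → ∃ (Chord u)
      chord-from {u} (_ , uncovered) u⊏b with Fin.any? (chord? u)
      ... | yes found = found
      ... | no none with u Fin.≟ a
      ...   | yes refl = ⊥-elim (⊏-irrefl (proj₁ (closed X stays (a⊏c , c⊏b)
                (proj₂ (proj₂ bic) b c a (⊏⇒≢ c⊏b) (⊏⇒≢ a⊏b)))))
        where
        X : V → Set
        X z = a ⊏ z × z ⊏ b
        stays : ∀ {z z′} → X z → z ~ z′ → z′ ≢ b → X z′
        stays {z} {z′} (a⊏z , z⊏b) zz′ z′≢b with z′ Fin.≟ a
        ... | yes refl = ⊥-elim (none (z , ~-sym zz′ , a⊏z , inj₁ z⊏b , λ { (_ , refl) → ⊏-irrefl z⊏b }))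
        ... | no z′≢a with ⊏-total z′≢b
        ...   | inj₁ z′⊏b = a⊏ z′≢a , z′⊏b
        ...   | inj₂ b⊏z′ = ⊥-elim (⊏-no-crossing ab zz′ a⊏z z⊏b b⊏z′)
      ...   | no u≢a = ⊥-elim (⊏-irrefl (⊑-⊏-trans (proj₂ (closed X stays (a⊏ u≢a , inj₂ refl)
                (proj₂ (proj₂ bic) a u b u≢a (≢-sym (⊏⇒≢ a⊏b))))) u⊏b))
        where
        X : V → Set
        X z = a ⊏ z × z ⊑ u
        -- An edge leaving this set past `u` either passes `b` and crosses `a b`, or starts at `u`
        -- and is the missing chord, or starts earlier and covers `u`.
        stays : ∀ {z z′} → X z → z ~ z′ → z′ ≢ a → X z′
        stays {z} {z′} (a⊏z , z⊑u) zz′ z′≢a with ⊏-or-⊒ u z′ | ⊏-or-⊒ b z′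
        ... | inj₂ z′⊑u | _         = a⊏ z′≢a , z′⊑u
        ... | inj₁ u⊏z′ | inj₁ b⊏z′ = ⊥-elim (⊏-no-crossing ab zz′ a⊏z (⊑-⊏-trans z⊑u u⊏b) b⊏z′)
        ... | inj₁ u⊏z′ | inj₂ z′⊑b with z⊑u
        ...   | inj₂ refl = ⊥-elim (none (z′ , zz′ , u⊏z′ , z′⊑b , λ (e , _) → u≢a e))
        ...   | inj₁ z⊏u  = ⊥-elim (uncovered (z , z′ ,
                  (zz′ , ⊏-trans z⊏u u⊏z′ , z′⊑b , λ (e , _) → ⊏⇒≢ a⊏z (≡-sym e)) , z⊏u , u⊏z′))

      -- Take the farthest end `w`. A chord covering `w` would start at `u` and be longer, or start
      -- before `u` and cover it, or start between and cross `u w`.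
      longest-chord : ∀ {u} → Visible u → u ⊏ b → ∃ λ w → Chord u w × Visible w
      longest-chord {u} vis u⊏b
        with maximum {_<_ = _⊏_} ⊏-trans _⊏?_ ⊏-irrefl (chord? u) (chord-from vis u⊏b)
      ... | w , ch@(uw , u⊏w , w⊑b , _) , top = w , ch , w⊑b , uncovered
        where
        uncovered : ¬ Covered w
        uncovered (x , y , (xy , x⊏y , y⊑b , ≢ab) , x⊏w , w⊏y) with x Fin.≟ u
        ... | yes refl = top y (xy , x⊏y , y⊑b , ≢ab) w⊏y
        ... | no x≢u with ⊏-total x≢u
        ...   | inj₁ x⊏u = proj₂ vis (x , y , (xy , x⊏y , y⊑b , ≢ab) , x⊏u , ⊏-trans u⊏w w⊏y)
        ...   | inj₂ u⊏x = ⊏-no-crossing uw xy u⊏x x⊏w w⊏y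

      S : Subset (n G)
      S = comprehension visible?

      ∈S : ∀ {v} → v ∈ S ⇔ Visible v
      ∈S = ∈-comprehension visible?

      private
        -- An edge other than `a b` between these vertices is a chord and covers everything between
        -- its ends, so no visible vertex is there.
        forward : ∀ {u v} → u ∈ S → v ∈ S → u ⊏ v → u ~ v → Side G pos S u v
        forward {u} {v} u∈ v∈ u⊏v uv with u Fin.≟ a ×-dec v Fin.≟ b
        ... | yes (refl , refl) = inj₂ (consec⇐ (≢-sym (⊏⇒≢ a⊏b)) λ {w} w∈ bwa →
                cyc-asym bwa (⊏⇒cyc (a⊏ (cyc-≢₂₃ bwa))
                  (Sum.[ (λ w⊏b → w⊏b) , (λ { refl → ⊥-elim (cyc-≢₁₂ bwa refl) }) ]
                    (proj₁ (to ∈S w∈)))))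
        ... | no ≢ab = inj₁ (consec⇐ (⊏⇒≢ u⊏v) λ w∈ p → proj₂ (to ∈S w∈)
                (u , v , (uv , u⊏v , proj₁ (to ∈S v∈) , ≢ab) , cyc⇒⊏ u⊏v p))

        -- The longest chord from `u` has a visible end. Before `v` that end would contradict
        -- consecutiveness, and beyond `v` the chord would cover `v`. In the wrapped case the
        -- visible `a` and `b` force `u` to be `a` and `v` to be `b`.
        backward : ∀ {u v} → u ∈ S → v ∈ S → u ⊏ v → Side G pos S u v → u ~ v
        backward {u} {v} u∈ v∈ u⊏v (inj₁ con)
          with longest-chord (to ∈S u∈) (⊏-⊑-trans u⊏v (proj₁ (to ∈S v∈)))
        ... | w , ch@(uw , u⊏w , _) , vis-w with v Fin.≟ w
        ...   | yes refl = uw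
        ...   | no v≢w with ⊏-total v≢w
        ...     | inj₁ v⊏w = ⊥-elim (proj₂ (to ∈S v∈) (u , w , ch , u⊏v , v⊏w))
        ...     | inj₂ w⊏v = ⊥-elim (consec⇒ con (from ∈S vis-w) (⊏⇒cyc u⊏w w⊏v))
        backward {u} {v} u∈ v∈ u⊏v (inj₂ con) with a⊑ u | proj₁ (to ∈S v∈)
        ... | inj₁ a⊏u  | _         = ⊥-elim (consec⇒ con (from ∈S visible-a) (cyc-rot² (⊏⇒cyc a⊏u u⊏v)))
        ... | inj₂ refl | inj₁ v⊏b  = ⊥-elim (consec⇒ con (from ∈S visible-b) (cyc-rot (⊏⇒cyc u⊏v v⊏b)))
        ... | inj₂ refl | inj₂ refl = ab

      face : Face G pos S
      face = three , λ u v u∈ v∈ u≢v → Sum.[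
          (λ u⊏v → mk⇔ (forward u∈ v∈ u⊏v) (backward u∈ v∈ u⊏v)) ,
          (λ v⊏u → mk⇔ (Sum.swap ∘ forward v∈ u∈ v⊏u ∘ ~-sym)
                       (~-sym ∘ backward v∈ u∈ v⊏u ∘ Sum.swap)) ] (⊏-total u≢v)
        where
        three : 3 ℕ.≤ ∣ S ∣
        three with longest-chord visible-a a⊏b
        ... | w , (_ , a⊏w , w⊑b , ≢ab) , vis-w =
          three≤∣ S ∣ (from ∈S visible-a) (from ∈S visible-b) (from ∈S vis-w)
            (⊏⇒≢ a⊏b) (≢-sym (⊏⇒≢ a⊏w)) (λ e → ≢ab (refl , e))

    -- The walk between two other vertices serves to give `v` an incident edge; a third vertex lies
    -- on one of its sides, and `Inner` supplies the face there.
    covered-by-face : Biconnected G → ∀ v → ∃ λ S → Face G pos S × v ∈ S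
    covered-by-face bic@(3≤n , _ , conn) v with another 3≤n v v
    ... | z , z≢v , _ with another 3≤n v z
    ... | y , y≢v , y≢z with conn y v z (≢-sym y≢v) (≢-sym y≢z)
    ... | Defs.here _ = ⊥-elim (z≢v refl)
    ... | step {v = w} _ vw _ with another 3≤n v w
    ... | x , x≢v , x≢w with cyc-total (≢-sym x≢v) x≢w (λ { refl → irrefl G v vw })
    ...   | inj₁ p = _ , Inner.face bic vw p , from (Inner.∈S bic vw p) (Inner.visible-a bic vw p)
    ...   | inj₂ p = _ , Inner.face bic (~-sym vw) p ,
                     from (Inner.∈S bic (~-sym vw) p) (Inner.visible-b bic (~-sym vw) p)

-- Following the faces along the weak dual

module Strip (G : Graph) (pos : Fin (n G) → Fin (n G)) (pos-injective : Injective _≡_ _≡_ pos)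
             (noCrossing : NoCrossing G pos)
             (k : ℕ) (F : Fin k → Subset (n G)) (F-injective : Injective _≡_ _≡_ F)
             (faces : ∀ i → Face G pos (F i))
             (dual : ∀ i j → FaceAdj G pos (F i) (F j) ⇔ (suc (toℕ i) ≡ toℕ j ⊎ suc (toℕ j) ≡ toℕ i))
             where

  open Circle G pos pos-injective
  open Plane noCrossing
  open Drawing V _~_ ~-sym

  ~⇒≢ : ∀ {u v} → u ~ v → u ≢ v
  ~⇒≢ {u} uv refl = irrefl G u uv

  Same : V → V → V → V → Set
  Same a b u l = (a ≡ u × b ≡ l) ⊎ (a ≡ l × b ≡ u)

  module _ {S} (P : Polygon S) where
    open Polygon P

    private
      c = corner

    -- An edge between corners that is not the closing one joins successive corners, the form that
    -- `cross-face` expects; the reversed orientation is reached by `swap`.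
    cross : ∀ {vs a b} → (∀ {w k} → w ∈ˡ vs → 0 ℕ.< k → k ℕ.< last → ¬ (w ~ c k)) →
      Rung vs (c 0) (c last) → a ∈ S → b ∈ S → a ~ b → ¬ Same a b (c 0) (c last) →
      ∃ λ us → Rung us a b × (∀ {w} → w ∈ˡ us ⇔ (w ∈ˡ vs ⊎ (w ∈ S × w ≢ a × w ≢ b)))
    cross {vs} apart r a∈ b∈ ab other with to members a∈ | to members b∈
    ... | i , i≤ , refl | j , j≤ , refl = by-order (ℕ.<-cmp i j)
      where
      open FaceStep V _~_ ~-sym c last cycle vs apart
      Result : ℕ → ℕ → Set
      Result i j = ∃ λ us → Rung us (c i) (c j) ×
        (∀ {w} → w ∈ˡ us ⇔ (w ∈ˡ vs ⊎ (w ∈ S × w ≢ c i × w ≢ c j)))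
      ordered : ∀ {i j} → i ℕ.< j → j ℕ.≤ last → c i ~ c j →
                ¬ Same (c i) (c j) (c 0) (c last) → Result i j
      ordered {i} {j} i<j j≤ ij other with to (cycle i<j j≤) ij
      ... | inj₂ (refl , refl) = ⊥-elim (other (inj₁ (refl , refl)))
      ... | inj₁ refl =
        let (us , d , r′) = cross-face i (last ℕ.∸ suc i) (≡-sym (ℕ.m+[n∸m]≡n j≤)) 2≤last r in
        us , r′ , λ {w} → mk⇔ (Sum.map₂ (λ { (k , done , refl) → sound done }) ∘ to (d w))
                              (from (d w) ∘ Sum.map₂ complete)
        where
        sound : ∀ {k} → Done i (suc i) k → c k ∈ S × c k ≢ c i × c k ≢ c (suc i)
        sound (inj₁ k<i) =
          from members (_ , ℕ.≤-trans (ℕ.<⇒≤ k<i) (ℕ.≤-trans (ℕ.<⇒≤ i<j) j≤) , refl) ,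
          distinct k<i (ℕ.<⇒≤ j≤) , distinct (ℕ.m<n⇒m<1+n k<i) j≤
        sound (inj₂ (i+1<k , k≤)) =
          from members (_ , k≤ , refl) ,
          ≢-sym (distinct (ℕ.<⇒≤ i+1<k) k≤) , ≢-sym (distinct i+1<k k≤)
        complete : ∀ {w} → w ∈ S × w ≢ c i × w ≢ c (suc i) → ∃ λ k → Done i (suc i) k × w ≡ c k
        complete (w∈ , w≢i , w≢j) with to members w∈
        ... | k , k≤ , refl with ℕ.<-cmp k i
        ... | tri< k<i _ _  = k , inj₁ k<i , refl
        ... | tri≈ _ refl _ = ⊥-elim (w≢i refl)
        ... | tri> _ _ i<k with ℕ.m≤n⇒m<n∨m≡n i<k
        ...   | inj₁ i+1<k = k , inj₂ (i+1<k , k≤) , refl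
        ...   | inj₂ refl  = ⊥-elim (w≢j refl)
      by-order : _ → Result i j
      by-order (tri≈ _ refl _) = ⊥-elim (~⇒≢ ab refl)
      by-order (tri< i<j _ _)  = ordered i<j j≤ ab other
      by-order (tri> _ _ j<i)  =
        let (us , r′ , mem) = ordered j<i i≤ (~-sym ab)
              (other ∘ Sum.[ (λ (p , q) → inj₂ (q , p)) , (λ (p , q) → inj₁ (q , p)) ]) in
        us , swap r′ , mk⇔ (Sum.map₂ (λ (p , q , s) → p , s , q) ∘ to mem)
                           (from mem ∘ Sum.map₂ (λ (p , q , s) → p , s , q))

  Shared : Fin k → Fin k → V → V → Set
  Shared i j u l = u ≢ l × u ∈ F i × l ∈ F i × u ∈ F j × l ∈ F j × u ~ l

  shared : ∀ {i j} → suc (toℕ i) ≡ toℕ j → ∃ λ u → ∃ λ l → Shared i j u l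
  shared e = proj₂ (from (dual _ _) (inj₁ e))

  not-shared : ∀ {i j u l} → suc (toℕ i) ℕ.< toℕ j → u ∈ F i → l ∈ F i → u ∈ F j → l ∈ F j → ¬ (u ~ l)
  not-shared {i} {j} {u} {l} i+1<j ui li uj lj ul
    with to (dual i j) ((λ e → i≢j (F-injective e)) , u , l , ~⇒≢ ul , ui , li , uj , lj , ul)
    where
    i≢j : i ≢ j
    i≢j refl = ℕ.<-asym i+1<j (ℕ.n<1+n _)
  ... | inj₁ e = ℕ.<-irrefl e i+1<j
  ... | inj₂ e = ℕ.<-asym i+1<j (ℕ.m≤n⇒m≤1+n (ℕ.≤-reflexive e))

  module _ {i′ i u l} (i′+1≡i : suc (toℕ i′) ≡ toℕ i) (sh : Shared i′ i u l)
           (con : Consec G pos (F i) l u) where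

    private
      u≢l = proj₁ sh
      ul : u ~ l
      ul = proj₂ (proj₂ (proj₂ (proj₂ (proj₂ sh))))

    -- By `con`, `F i` lies on the clockwise arc from `u` to `l`. A vertex of `F i′` inside this arc
    -- would put that whole face on the same side of `u l`, and the two faces would coincide.
    adjacent-behind : ∀ {w} → w ∈ F i′ → ¬ Cyc u w l
    adjacent-behind w∈ uwl = let (_ , ui′ , li′ , ui , li , _) = sh in
      i′≢i (F-injective (face-unique (faces i′) (faces i) ui′ li′ ui li u≢l
        (λ x∈ → one-sided (faces i′) ul w∈ x∈ uwl) (consec⇒ con)))
      where
      i′≢i : i′ ≢ i
      i′≢i refl = ℕ.1+n≢n i′+1≡i

    -- Induction backwards from `i′`. A face `F j` entering the arc lies wholly on that side of
    -- `u l`, while `F j⁺` avoids it, so the edge they share is `u l`. Then `F j` and `F i` would be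
    -- adjacent, although they are at least two apart in the path.
    behind : ∀ d j → d + toℕ j ≡ toℕ i′ → ∀ {w} → w ∈ F j → ¬ Cyc u w l
    behind zero j e w∈ with Fin.toℕ-injective {i = j} {j = i′} e
    ... | refl = adjacent-behind w∈
    behind (suc d) j e {w} w∈ uwl =
      let (p , q , p≢q , pj , qj , pj⁺ , qj⁺ , _) =
            shared {j} {j⁺} (≡-sym (Fin.toℕ-fromℕ< j+1<k)) in
      not-both p≢q pj qj (at-end pj pj⁺) (at-end qj qj⁺)
      where
      j<i′ : toℕ j ℕ.< toℕ i′
      j<i′ = subst (suc (toℕ j) ℕ.≤_) e (s≤s (ℕ.m≤n+m (toℕ j) d))
      j+1<k : suc (toℕ j) ℕ.< k
      j+1<k = ℕ.≤-<-trans j<i′ (Fin.toℕ<n i′)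
      j⁺ : Fin k
      j⁺ = Fin.fromℕ< j+1<k
      at-end : ∀ {s} → s ∈ F j → s ∈ F j⁺ → s ≡ u ⊎ s ≡ l
      at-end {s} sj sj⁺ with s Fin.≟ u | s Fin.≟ l
      ... | yes e | _ = inj₁ e
      ... | no _ | yes e = inj₂ e
      ... | no s≢u | no s≢l = ⊥-elim (one-sided (faces j) ul w∈ sj uwl
        (cyc-rot (cyc-flip (≢-sym s≢u) u≢l s≢l
          (behind d j⁺
            (trans (cong (d +_) (Fin.toℕ-fromℕ< j+1<k)) (trans (ℕ.+-suc d (toℕ j)) e)) sj⁺))))
      j+1<i : suc (toℕ j) ℕ.< toℕ i
      j+1<i = subst (suc (toℕ j) ℕ.<_) i′+1≡i (s≤s j<i′)
      not-both : ∀ {p q} → p ≢ q → p ∈ F j → q ∈ F j → p ≡ u ⊎ p ≡ l → q ≡ u ⊎ q ≡ l → ⊥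
      not-both p≢q pj qj (inj₁ refl) (inj₁ refl) = p≢q refl
      not-both p≢q pj qj (inj₂ refl) (inj₂ refl) = p≢q refl
      not-both p≢q pj qj (inj₁ refl) (inj₂ refl) = let (_ , _ , _ , ui , li , _) = sh in
        not-shared j+1<i pj qj ui li ul
      not-both p≢q pj qj (inj₂ refl) (inj₁ refl) = let (_ , _ , _ , ui , li , _) = sh in
        not-shared j+1<i qj pj ui li ul

    -- `w` and `x` lie strictly on opposite sides of the edge `u l`, so they differ and an edge
    -- between them would cross it.
    separated : ∀ {j w x} → toℕ j ℕ.≤ toℕ i′ → w ∈ F j → w ≢ u → w ≢ l →
                x ∈ F i → x ≢ u → x ≢ l → w ≢ x × ¬ (w ~ x)
    separated {j} {w} {x} j≤i′ w∈ w≢u w≢l x∈ x≢u x≢l =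
      (λ { refl → cyc-asym uxl lwu }) , λ wx → no-crossing ul (~-sym wx) uxl lwu
      where
      lwu : Cyc l w u
      lwu = cyc-rot (cyc-flip (≢-sym w≢u) u≢l w≢l
              (behind (toℕ i′ ℕ.∸ toℕ j) j (ℕ.m∸n+n≡m j≤i′) w∈))
      uxl : Cyc u x l
      uxl = cyc-rot (cyc-flip (≢-sym x≢l) (≢-sym u≢l) x≢u (consec⇒ con x∈))

  Behind : Fin k → V → Set
  Behind i w = ∃ λ j → toℕ j ℕ.≤ toℕ i × w ∈ F j

  record Stage (i : Fin k) (a b : V) : Set where
    field
      {vs}     : List V
      drawing  : Rung vs a b
      sound    : ∀ {w} → w ∈ˡ vs → Behind i w × w ≢ a × w ≢ b
      complete : ∀ {w} → Behind i w → w ∈ˡ vs ⊎ (w ≡ a ⊎ w ≡ b)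

  first : ∀ {i a b} → toℕ i ≡ 0 → a ∈ F i → b ∈ F i → a ~ b → Stage i a b
  -- The first face has no entrance edge. Listing it from a corner `z` off the exit edge makes a
  -- side at `z` serve as one.
  first {i} {a} {b} i≡0 a∈ b∈ ab with third (proj₁ (faces i)) a b
  ... | z , z∈ , z≢a , z≢b with enumerate-face (faces i) z∈
  ... | P , refl , _ with cross P {[]} (λ ())
          (start (from (Polygon.cycle P (ℕ.<⇒≤ (Polygon.2≤last P)) ℕ.≤-refl) (inj₂ (refl , refl))))
          a∈ b∈ ab Sum.[ (λ (e , _) → z≢a (≡-sym e)) , (λ (_ , e) → z≢b (≡-sym e)) ]
  ... | us , r , mem = record
    { drawing  = r
    ; sound    = λ w∈ → Sum.[ (λ ()) , (λ (w∈ , ≢ab) → (i , ℕ.≤-refl , w∈) , ≢ab) ] (to mem w∈)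
    ; complete = complete }
    where
    complete : ∀ {w} → Behind i w → w ∈ˡ us ⊎ (w ≡ a ⊎ w ≡ b)
    complete {w} (j , j≤i , w∈) with w Fin.≟ a | w Fin.≟ b
    ... | yes e | _ = inj₂ (inj₁ e)
    ... | no _ | yes e = inj₂ (inj₂ e)
    ... | no w≢a | no w≢b with Fin.toℕ-injective {i = j} {j = i}
                                 (ℕ.≤-antisym j≤i (subst (ℕ._≤ toℕ j) (≡-sym i≡0) z≤n))
    ...   | refl = inj₁ (from mem (inj₂ (w∈ , w≢a , w≢b)))

  advance : ∀ {i′ i u l a b} → suc (toℕ i′) ≡ toℕ i → Shared i′ i u l → Consec G pos (F i) l u →
            Stage i′ u l → a ∈ F i → b ∈ F i → a ~ b → ¬ (a ∈ F i′ × b ∈ F i′) → Stage i a b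
  advance {i′} {i} {u} {l} {a} {b} i′+1≡i sh@(u≢l , ui′ , li′ , ui , li , ul) con st a∈ b∈ ab new
    -- With `u` as corner `0`, its predecessor `l` is the last corner, so the frontier edge is the
    -- closing edge of the polygon.
    with enumerate-face (faces i) ui
  ... | P , refl , at-last with at-last li con
  ... | refl with cross P apart drawing a∈ b∈ ab
                (new ∘ Sum.[ (λ { (refl , refl) → ui′ , li′ }) , (λ { (refl , refl) → li′ , ui′ }) ])
    where
    open Stage st
    open Polygon P
    apart : ∀ {w k} → w ∈ˡ vs → 0 ℕ.< k → k ℕ.< last → ¬ (w ~ corner k)
    apart w∈ 0<k k<last = let ((j , j≤ , wj) , w≢u , w≢l) = sound w∈ in
      proj₂ (separated i′+1≡i sh con j≤ wj w≢u w≢l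
        (from members (_ , ℕ.<⇒≤ k<last , refl))
        (≢-sym (distinct 0<k (ℕ.<⇒≤ k<last))) (distinct k<last ℕ.≤-refl))
  ... | us , r , mem = record { drawing = r ; sound = sound′ ; complete = complete′ }
    where
    open Stage st
    i′≤i : toℕ i′ ℕ.≤ toℕ i
    i′≤i = subst (toℕ i′ ℕ.≤_) i′+1≡i (ℕ.n≤1+n _)
    differs : ∀ {w x} → w ∈ˡ vs → x ∈ F i → w ≢ x
    differs {w} {x} w∈ x∈ with sound w∈ | x Fin.≟ u | x Fin.≟ l
    ... | (_ , w≢u , _) | yes refl | _ = w≢u
    ... | (_ , _ , w≢l) | no _ | yes refl = w≢l
    ... | ((j , j≤ , wj) , w≢u , w≢l) | no x≢u | no x≢l =
      proj₁ (separated i′+1≡i sh con j≤ wj w≢u w≢l x∈ x≢u x≢l)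
    sound′ : ∀ {w} → w ∈ˡ us → Behind i w × w ≢ a × w ≢ b
    sound′ w∈ with to mem w∈
    ... | inj₂ (wi , ≢ab) = (i , ℕ.≤-refl , wi) , ≢ab
    ... | inj₁ w∈vs = let ((j , j≤ , wj) , _) = sound w∈vs in
      (j , ℕ.≤-trans j≤ i′≤i , wj) , differs w∈vs a∈ , differs w∈vs b∈
    on-face : ∀ {w} → w ∈ F i → w ∈ˡ us ⊎ (w ≡ a ⊎ w ≡ b)
    on-face {w} w∈ with w Fin.≟ a | w Fin.≟ b
    ... | yes e | _ = inj₂ (inj₁ e)
    ... | no _ | yes e = inj₂ (inj₂ e)
    ... | no w≢a | no w≢b = inj₁ (from mem (inj₂ (w∈ , w≢a , w≢b)))
    complete′ : ∀ {w} → Behind i w → w ∈ˡ us ⊎ (w ≡ a ⊎ w ≡ b)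
    complete′ (j , j≤i , wj) with ℕ.m≤n⇒m<n∨m≡n j≤i
    ... | inj₂ e with Fin.toℕ-injective {i = j} {j = i} e
    ...   | refl = on-face wj
    complete′ (j , j≤i , wj) | inj₁ j<i
      with complete (j , ℕ.s≤s⁻¹ (subst (suc (toℕ j) ℕ.≤_) (≡-sym i′+1≡i) j<i) , wj)
    ... | inj₁ w∈vs        = inj₁ (from mem (inj₁ w∈vs))
    ... | inj₂ (inj₁ refl) = on-face ui
    ... | inj₂ (inj₂ refl) = on-face li

  predecessor : ∀ {i : Fin k} {m} → toℕ i ≡ suc m → ∃ λ (i′ : Fin k) → toℕ i′ ≡ m
  predecessor {i} {m} e = Fin.fromℕ< m<k , Fin.toℕ-fromℕ< m<k
    where m<k : m ℕ.< k
          m<k = ℕ.<-trans (subst (m ℕ.<_) (≡-sym e) ℕ.≤-refl) (Fin.toℕ<n i)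

  entrance : ∀ {i′ i} → suc (toℕ i′) ≡ toℕ i →
             ∃ λ u → ∃ λ l → Shared i′ i u l × Consec G pos (F i) l u
  entrance {i′} {i} e with shared {i′} {i} e
  ... | u , l , sh@(u≢l , ui′ , li′ , ui , li , ul) with to (proj₂ (faces i) u l ui li u≢l) ul
  ... | inj₂ con = u , l , sh , con
  ... | inj₁ con = l , u , (≢-sym u≢l , li′ , ui′ , li , ui , ~-sym ul) , con

  -- The last hypothesis keeps the exit edge different from the entrance edge. The recursive call
  -- inherits it because `u l`, an edge of `F i`, cannot lie on a face two places earlier.
  stage : ∀ m {i a b} → toℕ i ≡ m → a ∈ F i → b ∈ F i → a ~ b →
          (∀ {j} → suc (toℕ j) ≡ toℕ i → ¬ (a ∈ F j × b ∈ F j)) → Stage i a b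
  stage zero    e a∈ b∈ ab _   = first e a∈ b∈ ab
  stage (suc m) {i} e a∈ b∈ ab new with predecessor {i} e
  ... | i′ , e′ with trans (cong suc e′) (≡-sym e)
  ... | i′+1≡i with entrance {i′} {i} i′+1≡i
  ... | u , l , sh@(_ , ui′ , li′ , ui , li , ul) , con =
    advance i′+1≡i sh con previous a∈ b∈ ab (new i′+1≡i)
    where
    previous : Stage i′ u l
    previous = stage m e′ ui′ li′ ul λ j+1≡i′ (uj , lj) →
      not-shared (ℕ.≤-reflexive (trans (cong suc j+1≡i′) i′+1≡i)) uj lj ui li ul

  -- The final face has no successor that fixes its exit edge. A side at a vertex absent from the
  -- previous face will do, since it cannot be the entrance edge; a corner off the entrance edge is
  -- such a vertex by `separated`.
  new-vertex : V → ∀ i → ∃ λ z → z ∈ F i × (∀ {j} → suc (toℕ j) ≡ toℕ i → z ∉ F j)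
  new-vertex v i with toℕ i in e
  ... | zero  = let (z , z∈ , _) = third {S = F i} (proj₁ (faces i)) v v in z , z∈ , λ ()
  ... | suc m with predecessor {i} e
  ... | i′ , e′ with trans (cong suc e′) (≡-sym e)
  ... | i′+1≡i with entrance {i′} {i} i′+1≡i
  ... | u , l , sh , con with third {S = F i} (proj₁ (faces i)) u l
  ... | z , z∈ , z≢u , z≢l = z , z∈ , λ {j} j+1≡ zj →
    proj₁ (separated i′+1≡i sh con
      (ℕ.≤-reflexive (trans (ℕ.suc-injective j+1≡) (≡-sym e′))) zj z≢u z≢l z∈ z≢u z≢l) refl

  represent-all : V → ∀ i → ∃ λ vs → Representation vs × (∀ {w} → Behind i w → w ∈ˡ vs)
  represent-all v i with new-vertex v i
  ... | z , z∈ , new with enumerate-face (faces i) z∈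
  ... | P , refl , _ = _ , represent (Rung.base drawing) , covers ∘ complete
    where
    covers : ∀ {w a b us} → w ∈ˡ us ⊎ (w ≡ a ⊎ w ≡ b) → w ∈ˡ a ∷ b ∷ us
    covers (inj₁ w∈)       = there (there w∈)
    covers (inj₂ (inj₁ e)) = here e
    covers (inj₂ (inj₂ e)) = there (here e)
    open Polygon P
    open Stage (stage (toℕ i) {i} refl z∈ (from members (_ , ℕ.≤-refl , refl))
      (from (cycle (ℕ.<⇒≤ 2≤last) ℕ.≤-refl) (inj₂ (refl , refl))) (λ e (zj , _) → new e zj))

theorem1 : (G : Graph) → Biconnected G → Outerpath G → B₀-VPG G
theorem1 G bic (pos , inj , nc , suc k , F , _ , F-inj , faces , all-faces , dual) =
  let (_ , rep , covers) = Strip.represent-all G pos inj nc (suc k) F F-inj faces dual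
                             (Fin.fromℕ< (ℕ.<⇒≤ (ℕ.<⇒≤ (proj₁ bic)))) (Fin.fromℕ k) in
  segments rep λ v →
    let (S , face , v∈) = covered-by-face bic v ; (i , Fi≡S) = all-faces S face in
    covers (i , subst (toℕ i ℕ.≤_) (≡-sym (Fin.toℕ-fromℕ k)) (Fin.toℕ≤pred[n] i) ,
            subst (v ∈_) (≡-sym Fi≡S) v∈)
  where
  open Circle G pos inj
  open Plane nc
  open Drawing V _~_ ~-sym
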